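{- Let $(G,\sigma)$ be a finite $d$-regular signed graph ($d\ge1$), equipped with the counting measure on vertices. Then $$2d\,\lambda_1^\sigma\;\ge\;\lambda_\infty^\sigma\;\ge\;\left(\sqrt{1+h_{out}^\sigma}-1\right)^2.$$
   Context: $G=(V,E)$ is a finite undirected graph, possibly with self-loops; $x\sim y$ means $\{x,y\}\in E$ (so $x\sim x$ if there is a self-loop at $x$). The degree of $x$ is $|\{y\in V: y\sim x\}|$ (a self-loop counts once); $G$ is $d$-regular if all degrees equal $d$. A signed graph $(G,\sigma)$ is a graph $G$ with a signature $\sigma:E\to\{+1,-1\}$, and $\sigma_{xy}=\sigma(\{x,y\})$. $\lambda_1^\sigma$ is the smallest eigenvalue of the normalized signed Laplacian $\Delta^\sigma f(x)=\frac1{d}\sum_{y:y\sim x}(f(x)-\sigma_{xy}f(y))$ acting on functions $f:V\to\mathbb R$. $\lambda_\infty^\sigma$ is the optimal (largest) constant such that for all $f:V\to\mathbb R$, $$\lambda_\infty^\sigma\sum_{x\in V}f(x)^2\le\sum_{x\in V}\sup_{y:y\sim x}|f(x)-\sigma_{xy}f(y)|^2 .$$ For $V_1\subseteq V$ let $\partial_{out}(V_1)=\{y\in V\setminus V_1:\exists\,x\in V_1,\ x\sim y\}$ and $$\iota_\infty^\sigma(V_1)=\min_{\tau:V_1\to\{+1,-1\}}\frac12\sum_{x\in V_1}\ \sup_{y\in V_1,\,y\sim x}|\tau(x)-\sigma_{xy}\tau(y)|,$$ where a supremum over the empty set is $0$. The outer vertex isoperimetric constant of the signed graph is $$h_{out}^\sigma=\min_{\emptyset\ne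 V_1\subseteq V}\frac{2\iota_\infty^\sigma(V_1)+|\partial_{out}(V_1)|}{|V_1|}.$$ -}

module Defs where

open import Level using (_⊔_; 0ℓ; Lift; lift)
open import Algebra.Bundles using (CommutativeRing)
open import Algebra.Core using (Op₁; Op₂)
open import Algebra.Structures using (IsCommutativeRing)
import Algebra.Construct.NaturalChoice.Max as Max
import Algebra.Properties.Monoid.Mult as Mult
import Algebra.Properties.Ring as RingProperties
import Algebra.Solver.Ring.NaturalCoefficients.Default as RingSolver
open import Data.Fin.Base using (Fin)
open import Data.Fin.Properties using (any?)
open import Data.Fin.Subset using (Subset; ⊤; ∣_∣)
open import Data.Fin.Subset.Properties using (_∈?_; nonempty?)
open import Data.List.Base
  using (List; []; _∷_; allFin; cartesianProductWith; filter; foldr; length; map)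
import Data.List.Extrema as Extrema
open import Data.Nat.Base using (ℕ; zero; suc)
open import Data.Product.Base using (∃; _×_; _,_; proj₁; proj₂)
open import Data.Bool.Base using (true; false)
open import Data.Sign.Base using (Sign)
open import Data.Sum.Base using (inj₁; inj₂)
open import Data.Vec.Base using (Vec; []; _∷_; lookup; replicate)
open import Relation.Binary.Bundles using (TotalOrder)
open import Relation.Binary.Core using (Rel)
open import Relation.Binary.Definitions using (Decidable; Symmetric)
open import Relation.Binary.PropositionalEquality.Core using (_≡_)
open import Relation.Binary.Structures using (IsDecTotalOrder)
open import Relation.Nullary.Decidable.Core using (yes; no; ¬?; _×-dec_)
open import Relation.Nullary.Negation.Core using (¬_)
open import Relation.Unary using (Pred)

-- The classical real numbers, characterised (up to unique isomorphism) as the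
-- Dedekind-complete ordered field.  The inverse is total; its value at 0# is
-- not constrained.

record CompleteOrderedField c ℓ₁ ℓ₂ : Set (Level.suc (c ⊔ ℓ₁ ⊔ ℓ₂)) where
  infix  8 -_
  infix  9 _⁻¹
  infixl 7 _*_
  infixl 6 _+_
  infix  4 _≈_ _≤_

  field
    Carrier           : Set c
    _≈_               : Rel Carrier ℓ₁
    _≤_               : Rel Carrier ℓ₂
    _+_ _*_           : Op₂ Carrier
    -_ _⁻¹            : Op₁ Carrier
    0# 1#             : Carrier
    isCommutativeRing : IsCommutativeRing _≈_ _+_ _*_ -_ 0# 1#
    isDecTotalOrder   : IsDecTotalOrder _≈_ _≤_
    0≉1               : ¬ (0# ≈ 1#)
    ⁻¹-cong           : ∀ {x y} → x ≈ y → x ⁻¹ ≈ y ⁻¹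
    *-inverseʳ        : ∀ {x} → ¬ (x ≈ 0#) → x * x ⁻¹ ≈ 1#
    +-monoˡ-≤         : ∀ z {x y} → x ≤ y → x + z ≤ y + z
    *-nonneg          : ∀ {x y} → 0# ≤ x → 0# ≤ y → 0# ≤ x * y

  IsUpperBound : ∀ {p} → Pred Carrier p → Pred Carrier (c ⊔ ℓ₂ ⊔ p)
  IsUpperBound P u = ∀ x → P x → x ≤ u

  field
    supremum : (P : Pred Carrier (c ⊔ ℓ₁ ⊔ ℓ₂)) → ∃ P → ∃ (IsUpperBound P) →
               ∃ λ s → IsUpperBound P s × (∀ u → IsUpperBound P u → s ≤ u)

module RealOperations {c ℓ₁ ℓ₂} (ℝ : CompleteOrderedField c ℓ₁ ℓ₂) where
  open CompleteOrderedField ℝ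

  commutativeRing : CommutativeRing c ℓ₁
  commutativeRing = record { isCommutativeRing = isCommutativeRing }

  totalOrder : TotalOrder c ℓ₁ ℓ₂
  totalOrder = record { isTotalOrder = IsDecTotalOrder.isTotalOrder isDecTotalOrder }

  open CommutativeRing commutativeRing public
    using (_-_; +-monoid; commutativeSemiring; setoid; ring; +-cong; +-comm; +-assoc;
           *-cong; *-comm; *-assoc; *-identityʳ; *-identityˡ; zeroʳ; distribˡ;
           -‿inverseʳ; +-identityʳ; +-identityˡ)
    renaming (refl to ≈-refl; sym to ≈-sym; trans to ≈-trans)

  open TotalOrder totalOrder
    using (total; antisym; ≤-respˡ-≈; ≤-respʳ-≈)
    renaming (refl to ≤-refl; trans to ≤-trans; reflexive to ≤-reflexive)
  open IsDecTotalOrder isDecTotalOrder using (_≟_)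
  open RingSolver commutativeSemiring using (solve; _:+_; _:*_; con; _:=_)
  open Mult +-monoid using () renaming (_×_ to _×ℕ_)

  ≤-cong : ∀ {x x′ y y′} → x ≈ x′ → y ≈ y′ → x ≤ y → x′ ≤ y′
  ≤-cong p q x≤y = ≤-respˡ-≈ p (≤-respʳ-≈ q x≤y)

  +-monoʳ-≤ : ∀ z {x y} → x ≤ y → z + x ≤ z + y
  +-monoʳ-≤ z x≤y = ≤-cong (+-comm _ z) (+-comm _ z) (+-monoˡ-≤ z x≤y)

  +-mono-≤ : ∀ {x y u v} → x ≤ y → u ≤ v → x + u ≤ y + v
  +-mono-≤ {y = y} {u} x≤y u≤v = ≤-trans (+-monoˡ-≤ u x≤y) (+-monoʳ-≤ y u≤v)

  cancel : ∀ x z → (x + z) + - z ≈ x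
  cancel x z = ≈-trans (+-assoc x z (- z))
    (≈-trans (+-cong ≈-refl (-‿inverseʳ z)) (+-identityʳ x))

  +-cancelʳ-≤ : ∀ z {x y} → x + z ≤ y + z → x ≤ y
  +-cancelʳ-≤ z {x} {y} p = ≤-cong (cancel x z) (cancel y z) (+-monoˡ-≤ (- z) p)

  difference : ∀ {x y} → x ≤ y → ∃ λ d → 0# ≤ d × y ≈ x + d
  difference {x} {y} x≤y =
    y - x , ≤-cong (-‿inverseʳ x) ≈-refl (+-monoˡ-≤ (- x) x≤y) ,
    ≈-sym (≈-trans (+-comm x (y - x)) (≈-trans (+-assoc y (- x) x)
      (≈-trans (+-cong ≈-refl (≈-trans (+-comm (- x) x) (-‿inverseʳ x))) (+-identityʳ y))))

  x≤x+d : ∀ {x d} → 0# ≤ d → x ≤ x + d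
  x≤x+d {x} 0≤d = ≤-cong (+-identityʳ x) ≈-refl (+-monoʳ-≤ x 0≤d)

  +-nonneg : ∀ {x y} → 0# ≤ x → 0# ≤ y → 0# ≤ x + y
  +-nonneg 0≤x 0≤y = ≤-trans 0≤x (x≤x+d 0≤y)

  *-monoʳ-≤ : ∀ {z x y} → 0# ≤ z → x ≤ y → z * x ≤ z * y
  *-monoʳ-≤ {z} {x} 0≤z x≤y with difference x≤y
  ... | d , 0≤d , y≈x+d =
    ≤-cong ≈-refl (≈-sym (≈-trans (*-cong ≈-refl y≈x+d) (distribˡ z x d)))
      (x≤x+d (*-nonneg 0≤z 0≤d))

  *-square-nonneg : ∀ x → 0# ≤ x * x
  *-square-nonneg x with total 0# x
  ... | inj₁ 0≤x = *-nonneg 0≤x 0≤x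
  ... | inj₂ x≤0 with difference x≤0
  ...   | d , 0≤d , 0≈x+d = ≤-respʳ-≈ d²≈x² (*-nonneg 0≤d 0≤d)
    where
    open RingProperties ring using (-‿distribˡ-*; -‿distribʳ-*; -‿involutive; +-inverseʳ-unique)
    d≈-x : d ≈ - x
    d≈-x = +-inverseʳ-unique x d (≈-sym 0≈x+d)
    d²≈x² : d * d ≈ x * x
    d²≈x² = ≈-trans (*-cong d≈-x d≈-x)
      (≈-trans (≈-sym (-‿distribˡ-* x (- x)))
        (≈-trans (CommutativeRing.-‿cong commutativeRing (≈-sym (-‿distribʳ-* x x)))
          (-‿involutive (x * x))))

  0≤1 : 0# ≤ 1#
  0≤1 = ≤-respʳ-≈ (*-identityʳ 1#) (*-square-nonneg 1#)

  *-cancelˡ-≤ : ∀ {z x y} → 0# ≤ z → ¬ (z ≈ 0#) → z * x ≤ z * y → x ≤ y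
  *-cancelˡ-≤ {z} {x} {y} 0≤z z≉0 p with total x y
  ... | inj₁ x≤y = x≤y
  ... | inj₂ y≤x = ≤-reflexive (≈-trans (≈-sym (z⁻¹*z* x))
                     (≈-trans (*-cong ≈-refl (antisym p (*-monoʳ-≤ 0≤z y≤x))) (z⁻¹*z* y)))
    where
    z⁻¹*z* : ∀ w → z ⁻¹ * (z * w) ≈ w
    z⁻¹*z* w = ≈-trans (≈-sym (*-assoc (z ⁻¹) z w))
      (≈-trans (*-cong (≈-trans (*-comm (z ⁻¹) z) (*-inverseʳ z≉0)) ≈-refl) (*-identityˡ w))

  0≤x+y≈0⇒x≈0 : ∀ {x y} → 0# ≤ x → 0# ≤ y → x + y ≈ 0# → x ≈ 0#
  0≤x+y≈0⇒x≈0 0≤x 0≤y p = antisym (≤-respʳ-≈ p (x≤x+d 0≤y)) 0≤x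

  amgm-≤ : ∀ {x r} → r ≤ x → r * x + r * x ≤ r * r + x * x
  amgm-≤ {x} {r} r≤x with difference r≤x
  ... | d , _ , x≈r+d = ≤-cong
    (≈-sym (+-cong r*x≈ r*x≈))
    (≈-trans (solve 2 (λ r d → (r :* (r :+ d) :+ r :* (r :+ d)) :+ d :* d
                                   := r :* r :+ (r :+ d) :* (r :+ d)) ≈-refl r d)
      (+-cong ≈-refl (≈-sym (*-cong x≈r+d x≈r+d))))
    (x≤x+d (*-square-nonneg d))
    where
    r*x≈ : r * x ≈ r * (r + d)
    r*x≈ = *-cong ≈-refl x≈r+d

  amgm : ∀ x r → r * x + r * x ≤ r * r + x * x
  amgm x r with total r x
  ... | inj₁ r≤x = amgm-≤ r≤x
  ... | inj₂ x≤r = ≤-cong (+-cong (*-comm x r) (*-comm x r)) (+-comm _ _) (amgm-≤ x≤r)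

  sqrt : ∀ a → 0# ≤ a → ∃ λ r → 0# ≤ r × r * r ≈ a
  sqrt a 0≤a = r , 0≤r , antisym r²≤a a≤r²
    where
    S : Pred Carrier (c ⊔ ℓ₁ ⊔ ℓ₂)
    S x = Lift (c ⊔ ℓ₁ ⊔ ℓ₂) (x * x ≤ a)

    k : Carrier
    k = 1# + a

    0≤k : 0# ≤ k
    0≤k = +-nonneg 0≤1 0≤a

    a≤k : a ≤ k
    a≤k = ≤-respʳ-≈ (+-comm a 1#) (x≤x+d 0≤1)

    bounded : IsUpperBound S k
    bounded x (lift x²≤a) with total x k
    ... | inj₁ x≤k = x≤k
    ... | inj₂ k≤x = ≤-trans (≤-cong (*-identityʳ x) ≈-refl (*-monoʳ-≤ 0≤x 1≤x))
                       (≤-trans x²≤a a≤k)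
      where
      0≤x : 0# ≤ x
      0≤x = ≤-trans 0≤k k≤x
      1≤x : 1# ≤ x
      1≤x = ≤-trans (x≤x+d 0≤a) k≤x

    0∈S : S 0#
    0∈S = lift (≤-respˡ-≈ (≈-sym (zeroʳ 0#)) 0≤a)

    sup : ∃ λ s → IsUpperBound S s × (∀ u → IsUpperBound S u → s ≤ u)
    sup = supremum S (0# , 0∈S) (k , bounded)

    r : Carrier
    r = proj₁ sup

    upper : IsUpperBound S r
    upper = proj₁ (proj₂ sup)

    0≤r : 0# ≤ r
    0≤r = upper 0# 0∈S

    r²≤a : r * r ≤ a
    r²≤a with r ≟ 0#
    ... | yes r≈0 = ≤-respˡ-≈ (≈-sym (≈-trans (*-cong r≈0 r≈0) (zeroʳ 0#))) 0≤a
    ... | no  r≉0 = +-cancelʳ-≤ (r * r) (≤-cong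
                      (distribʳ-r) (≈-trans z*y≈ (+-comm _ _))
                      (*-monoʳ-≤ 0≤z (proj₂ (proj₂ sup) y y-upper)))
      where
      z y : Carrier
      z = r + r
      y = z ⁻¹ * (r * r + a)
      0≤z : 0# ≤ z
      0≤z = +-nonneg 0≤r 0≤r
      z≉0 : ¬ (z ≈ 0#)
      z≉0 z≈0 = r≉0 (0≤x+y≈0⇒x≈0 0≤r 0≤r z≈0)
      distribʳ-r : z * r ≈ r * r + r * r
      distribʳ-r = solve 1 (λ r → (r :+ r) :* r := r :* r :+ r :* r) ≈-refl r
      z*y≈ : z * y ≈ r * r + a
      z*y≈ = ≈-trans (≈-sym (*-assoc z (z ⁻¹) _))
        (≈-trans (*-cong (*-inverseʳ z≉0) ≈-refl) (*-identityˡ _))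
      y-upper : IsUpperBound S y
      y-upper x (lift x²≤a) = *-cancelˡ-≤ 0≤z z≉0 (≤-cong
        (solve 2 (λ r x → r :* x :+ r :* x := (r :+ r) :* x) ≈-refl r x)
        (≈-sym z*y≈)
        (≤-trans (amgm x r) (+-monoʳ-≤ (r * r) x²≤a)))

    -- The point (k r + a) / (k + r) lies in S, because r² ≤ a ≤ k².
    a≤r² : a ≤ r * r
    a≤r² = +-cancelʳ-≤ (k * r) (≤-cong
      (≈-trans m*y≈ (+-comm _ _))
      (solve 2 (λ k r → (k :+ r) :* r := r :* r :+ k :* r) ≈-refl k r)
      (*-monoʳ-≤ 0≤m (upper y (lift y²≤a))))
      where
      m y : Carrier
      m = k + r
      y = m ⁻¹ * (k * r + a)
      0≤m : 0# ≤ m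
      0≤m = +-nonneg 0≤k 0≤r
      m≉0 : ¬ (m ≈ 0#)
      m≉0 m≈0 = 0≉1 (≈-sym (0≤x+y≈0⇒x≈0 0≤1 0≤a (0≤x+y≈0⇒x≈0 0≤k 0≤r m≈0)))
      m²≉0 : ¬ (m * m ≈ 0#)
      m²≉0 m²≈0 = m≉0 (≈-trans (≈-sym (*-identityʳ m))
        (≈-trans (*-cong ≈-refl (≈-sym (*-inverseʳ m≉0)))
        (≈-trans (≈-sym (*-assoc m m (m ⁻¹)))
        (≈-trans (*-cong m²≈0 ≈-refl) (≈-trans (*-comm 0# _) (zeroʳ _))))))
      m*y≈ : m * y ≈ k * r + a
      m*y≈ = ≈-trans (≈-sym (*-assoc m (m ⁻¹) _))
        (≈-trans (*-cong (*-inverseʳ m≉0) ≈-refl) (*-identityˡ _))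
      main : (k * r + a) * (k * r + a) ≤ (m * m) * a
      main with difference r²≤a
      ... | δ , 0≤δ , a≈r²+δ = ≤-cong ≈-refl rhs (x≤x+d 0≤rest)
        where
        -- (k r + a)² + δ (k² - a) = (k + r)² a, where k² - a = 1 + a + a².
        rest : Carrier
        rest = δ * (1# + a + a * a)
        0≤rest : 0# ≤ rest
        0≤rest = *-nonneg 0≤δ (+-nonneg (+-nonneg 0≤1 0≤a) (*-square-nonneg a))
        rhs : (k * r + a) * (k * r + a) + rest ≈ (m * m) * a
        rhs = ≈-trans
          (solve 3 (λ a r δ →
             let k = con 1 :+ a in
             (k :* r :+ a) :* (k :* r :+ a) :+ δ :* (con 1 :+ a :+ a :* a)
               := (k :* k :* (r :* r) :+ (k :* r :* a :+ k :* r :* a)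
                   :+ δ :* (con 1 :+ a :+ a :* a)) :+ a :* a) ≈-refl a r δ)
          (≈-trans (+-cong ≈-refl (*-cong ≈-refl a≈r²+δ))
          (≈-trans
          (solve 3 (λ a r δ →
             let k = con 1 :+ a in
             (k :* k :* (r :* r) :+ (k :* r :* a :+ k :* r :* a)
                   :+ δ :* (con 1 :+ a :+ a :* a)) :+ a :* (r :* r :+ δ)
               := ((k :* r :* a :+ k :* r :* a) :+ r :* r :* a)
                   :+ k :* k :* (r :* r :+ δ)) ≈-refl a r δ)
          (≈-trans (+-cong ≈-refl (*-cong ≈-refl (≈-sym a≈r²+δ)))
          (solve 2 (λ a r →
             let k = con 1 :+ a in
             ((k :* r :* a :+ k :* r :* a) :+ r :* r :* a) :+ k :* k :* a
               := (k :+ r) :* (k :+ r) :* a) ≈-refl a r))))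
      y²≤a : y * y ≤ a
      y²≤a = *-cancelˡ-≤ (*-square-nonneg m) m²≉0 (≤-cong
        (≈-trans (≈-sym (*-cong m*y≈ m*y≈))
          (solve 2 (λ m y → (m :* y) :* (m :* y) := (m :* m) :* (y :* y)) ≈-refl m y))
        ≈-refl main)

  -- Zero on negative arguments.
  √_ : Op₁ Carrier
  √ a with total 0# a
  ... | inj₁ 0≤a = proj₁ (sqrt a 0≤a)
  ... | inj₂ _   = 0#

  infix 9 √_ _²

  _² : Op₁ Carrier
  x ² = x * x

  ½ : Carrier
  ½ = (1# + 1#) ⁻¹

  ∣_∣ᵣ : Op₁ Carrier
  ∣ x ∣ᵣ = x ⊔ᵣ (- x)
    where open Max totalOrder using () renaming (_⊔_ to _⊔ᵣ_)

  ofℕ : ℕ → Carrier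
  ofℕ m = m ×ℕ 1#

  ofSign : Sign → Carrier
  ofSign Sign.+ = 1#
  ofSign Sign.- = - 1#

  module _ {a} {A : Set a} where

    ∑ : List A → (A → Carrier) → Carrier
    ∑ xs f = foldr _+_ 0# (map f xs)

    -- Supremum of a family of nonnegative reals, the empty supremum being 0#.
    sup₀ : List A → (A → Carrier) → Carrier
    sup₀ xs f = Extrema.max totalOrder 0# (map f xs)

    -- Minimum of f over the nonempty collection consisting of x and xs.
    minimum : A → List A → (A → Carrier) → Carrier
    minimum x xs f = Extrema.min totalOrder (f x) (map f xs)

allVecs : ∀ {a} {A : Set a} → List A → ∀ n → List (Vec A n)
allVecs xs zero    = [] ∷ []
allVecs xs (suc n) = cartesianProductWith _∷_ xs (allVecs xs n)

-- Finite undirected graphs on the vertex set Fin n; self-loops x ∼ x are allowed.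
record Graph (n : ℕ) : Set₁ where
  infix 4 _∼_ _∼?_
  field
    _∼_   : Rel (Fin n) 0ℓ
    ∼-sym : Symmetric _∼_
    _∼?_  : Decidable _∼_

  neighbours : Fin n → List (Fin n)
  neighbours x = filter (_∼? x) (allFin n)

  degree : Fin n → ℕ
  degree x = length (neighbours x)

  Regular : ℕ → Set
  Regular d = ∀ x → degree x ≡ d

  ∂out : Subset n → List (Fin n)
  ∂out V₁ = filter (λ y → ¬? (y ∈? V₁) ×-dec any? (λ x → (x ∈? V₁) ×-dec (x ∼? y))) (allFin n)

-- The sign of an edge {x , y} is σ x y.  Values of σ at non-adjacent pairs are
-- unconstrained and never enter the constants below.
record Signature {n} (G : Graph n) : Set where
  open Graph G
  field
    σ     : Fin n → Fin n → Sign
    σ-sym : ∀ {x y} → x ∼ y → σ x y ≡ σ y x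

module SignedGraphConstants
  {c ℓ₁ ℓ₂} (ℝ : CompleteOrderedField c ℓ₁ ℓ₂)
  {n : ℕ} (G : Graph n) (S : Signature G) where

  open CompleteOrderedField ℝ
  open RealOperations ℝ
  open Graph G
  open Signature S

  vertices : List (Fin n)
  vertices = allFin n

  Δ : ℕ → (Fin n → Carrier) → Fin n → Carrier
  Δ d f x = (ofℕ d) ⁻¹ * ∑ (neighbours x) (λ y → f x - ofSign (σ x y) * f y)

  IsEigenvalue : ℕ → Carrier → Set (c ⊔ ℓ₁)
  IsEigenvalue d μ = ∃ λ (f : Fin n → Carrier) → (∃ λ x → ¬ (f x ≈ 0#)) × (∀ x → Δ d f x ≈ μ * f x)

  IsSmallestEigenvalue : ℕ → Carrier → Set (c ⊔ ℓ₁ ⊔ ℓ₂)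
  IsSmallestEigenvalue d λ₁ = IsEigenvalue d λ₁ × (∀ μ → IsEigenvalue d μ → λ₁ ≤ μ)

  IsPoincaréConstant : Carrier → Set (c ⊔ ℓ₂)
  IsPoincaréConstant μ = ∀ (f : Fin n → Carrier) →
    μ * ∑ vertices (λ x → f x ²)
      ≤ ∑ vertices (λ x → sup₀ (neighbours x) (λ y → ∣ f x - ofSign (σ x y) * f y ∣ᵣ ²))

  IsOptimalPoincaréConstant : Carrier → Set (c ⊔ ℓ₂)
  IsOptimalPoincaréConstant λ∞ =
    IsPoincaréConstant λ∞ × (∀ μ → IsPoincaréConstant μ → μ ≤ λ∞)

  -- τ is given on all of V, but only its restriction to V₁ is used.
  frustration : Subset n → Vec Sign n → Carrier
  frustration V₁ τ =
    ½ * ∑ (filter (_∈? V₁) vertices) (λ x →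
          sup₀ (filter (_∈? V₁) (neighbours x)) (λ y →
            ∣ ofSign (lookup τ x) - ofSign (σ x y) * ofSign (lookup τ y) ∣ᵣ))

  ι∞ : Subset n → Carrier
  ι∞ V₁ = minimum (replicate n Sign.+) (allVecs (Sign.+ ∷ Sign.- ∷ []) n) (frustration V₁)

  ratio : Subset n → Carrier
  ratio V₁ = ((1# + 1#) * ι∞ V₁ + ofℕ (length (∂out V₁))) * (ofℕ ∣ V₁ ∣) ⁻¹

  -- The minimum over the nonempty subsets of V; if V is nonempty, the first argument
  -- ⊤ (the whole of V) is one of them.
  hout : Carrier
  hout = minimum ⊤ (filter nonempty? (allVecs (true ∷ false ∷ []) n)) ratio

{-# OPTIONS --safe #-}
module Submission where

-- Upper bound: write g(x,y) = f(x) - σ_xy f(y).  Then g(x,y)² = f(x) g(x,y) + f(y) g(y,x), so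
-- Σ_x Σ_{y∼x} g(x,y)² = 2d ⟨f, Δf⟩, while a supremum of nonnegative terms is at most their sum.
--
-- Lower bound: put κ = √(1+h) - 1, a = |f| and s(x) = sup_{y∼x} |g(x,y)|.  Apply the
-- definition of h to the sets {f² > t} with τ = sign f and integrate over t.  A neighbour y in
-- conflict with x has s(x) ≥ a(x) + a(y), so the conflict at x survives only up to the level b²
-- with b = max 0 (min a (s - a)), and every neighbour has f(y)² ≤ (a + s)².  This gives
-- (1+h) Σ f² ≤ Σ (2b² + (a+s)²).  We conclude with
-- κ (2b² + (a+s)²) ≤ (κ+1) s² + κ(κ+1) a², which follows from (s - κa)² ≥ 2κ b².
-- The latter holds because V itself is admissible in the definition of h, whence h ≤ 2,
-- κ ≤ 1 and 2κ ≤ (2-κ)², while s - κa ≥ (2-κ) b whenever b > 0.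

open import Algebra.Bundles using (CommutativeRing)
import Algebra.Construct.NaturalChoice.Max as Max
import Algebra.Properties.Ring as RingProperties
import Algebra.Solver.Ring.NaturalCoefficients.Default as RingSolver
open import Data.Bool.Base using (if_then_else_; not; true; false)
open import Data.Fin.Base using (Fin; zero; suc)
open import Data.Fin.Subset using (Subset; ⊤; ∣_∣; Nonempty) renaming (_∈_ to _∈ₛ_)
open import Data.Fin.Subset.Properties
  using (_∈?_; nonempty?; ∈⊤; Empty-unique; ∣⊥∣≡0; x∈p⇒∣p-x∣<∣p∣)
open import Data.List.Base as List using (List; []; _∷_; _++_; allFin; filter; length; map)
import Data.List.Extrema as Extrema
open import Data.List.Membership.Propositional using (_∈_)
open import Data.List.Membership.Propositional.Properties
  using (∈-map⁺; ∈-++⁺ˡ; ∈-++⁺ʳ; ∈-filter⁺; ∈-filter⁻; ∈-allFin; ∈-cartesianProductWith⁺)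
open import Data.List.Relation.Binary.Permutation.Propositional using (↭-sym)
open import Data.List.Relation.Binary.Permutation.Propositional.Properties using (∈-resp-↭)
open import Data.List.Relation.Unary.All as All using (All; []; _∷_)
import Data.List.Relation.Unary.All.Properties as All
open import Data.List.Relation.Unary.AllPairs using (AllPairs; []; _∷_)
open import Data.List.Relation.Unary.Any using (here; there)
open import Data.List.Relation.Unary.Sorted.TotalOrder.Properties using (Sorted⇒AllPairs)
import Data.List.Sort as Sort
open import Data.Nat.Base using (ℕ; zero; suc; s≤s; z≤n) renaming (_≤_ to _≤ℕ_)
import Data.Nat.Properties as ℕ
open import Data.Product.Base using (∃; _×_; _,_; proj₁; proj₂)
open import Data.Sign.Base using (Sign)
open import Data.Sum.Base using (_⊎_; inj₁; inj₂)
import Data.Sum.Base as Sum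
open import Data.Vec.Base as Vec using (Vec; []; _∷_; lookup; tabulate)
open import Data.Vec.Properties using (lookup∘tabulate; lookup⇒[]=; []=⇒lookup)
open import Function.Base using (_∘_; id)
open import Relation.Binary.Bundles using (DecTotalOrder; TotalOrder)
open import Relation.Binary.PropositionalEquality.Core using (_≡_; refl; sym; trans; cong; cong₂)
import Relation.Binary.Reasoning.PartialOrder as PartialOrderReasoning
open import Relation.Binary.Structures using (IsDecTotalOrder)
open import Relation.Nullary.Decidable.Core using (does; yes; no)
open import Relation.Nullary.Negation.Core using (¬_; contradiction)
open import Relation.Unary using (Pred; Decidable)
open import Defs

-- Order arithmetic, inverses and square roots.

module OrderedFieldProperties {c ℓ₁ ℓ₂} (ℝ : CompleteOrderedField c ℓ₁ ℓ₂) where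
  open CompleteOrderedField ℝ
  open RealOperations ℝ
  open IsDecTotalOrder isDecTotalOrder public
    using (_≟_; _≤?_; total; antisym)
    renaming (refl to ≤-refl; trans to ≤-trans; reflexive to ≤-reflexive)
  open RingProperties ring public
    using (-‿distribˡ-*; -‿distribʳ-*; -‿involutive)
  open RingSolver commutativeSemiring public using (solve; _:+_; _:*_; con; _:=_)
  open CommutativeRing commutativeRing public using (-‿cong) renaming (reflexive to ≈-reflexive)
  open TotalOrder totalOrder using (poset)
  open PartialOrderReasoning poset public

  decTotalOrder : DecTotalOrder c ℓ₁ ℓ₂
  decTotalOrder = record { isDecTotalOrder = isDecTotalOrder }

  x-y+y≈x : ∀ x y → (x - y) + y ≈ x
  x-y+y≈x x y = ≈-trans (+-assoc x (- y) y) (≈-trans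
    (+-cong ≈-refl (≈-trans (+-comm (- y) y) (-‿inverseʳ y))) (+-identityʳ x))

  x≤y⇒0≤y-x : ∀ {x y} → x ≤ y → 0# ≤ y - x
  x≤y⇒0≤y-x {x} x≤y = ≤-cong (-‿inverseʳ x) ≈-refl (+-monoˡ-≤ (- x) x≤y)

  2# : Carrier
  2# = 1# + 1#

  0≤2 : 0# ≤ 2#
  0≤2 = +-nonneg 0≤1 0≤1

  1≤2 : 1# ≤ 2#
  1≤2 = x≤x+d 0≤1

  *-monoˡ-≤ : ∀ {z x y} → 0# ≤ z → x ≤ y → x * z ≤ y * z
  *-monoˡ-≤ 0≤z x≤y = ≤-cong (*-comm _ _) (*-comm _ _) (*-monoʳ-≤ 0≤z x≤y)

  *-mono-≤ : ∀ {x y u v} → 0# ≤ y → 0# ≤ u → x ≤ y → u ≤ v → x * u ≤ y * v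
  *-mono-≤ 0≤y 0≤u x≤y u≤v = ≤-trans (*-monoˡ-≤ 0≤u x≤y) (*-monoʳ-≤ 0≤y u≤v)

  ²-mono-≤ : ∀ {x y} → 0# ≤ x → x ≤ y → x ² ≤ y ²
  ²-mono-≤ 0≤x x≤y = *-mono-≤ (≤-trans 0≤x x≤y) 0≤x x≤y x≤y

  -- The sign of `x` is free: if `y ≤ x` then `x` is nonnegative too, and x² ≤ y² ≤ yx can be
  -- divided by `x`.
  ²-cancel-≤ : ∀ {x y} → 0# ≤ y → x ² ≤ y ² → x ≤ y
  ²-cancel-≤ {x} {y} 0≤y x²≤y² with total x y | x ≟ 0#
  ... | inj₁ x≤y | _       = x≤y
  ... | inj₂ _   | yes x≈0 = ≤-trans (≤-reflexive x≈0) 0≤y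
  ... | inj₂ y≤x | no  x≉0 =
    *-cancelˡ-≤ (≤-trans 0≤y y≤x) x≉0 (≤-trans x²≤y² (*-monoˡ-≤ 0≤y y≤x))

  2≉0 : ¬ (2# ≈ 0#)
  2≉0 2≈0 = 0≉1 (≈-sym (0≤x+y≈0⇒x≈0 0≤1 0≤1 2≈0))

  ½-inverse : ∀ x → 2# * (½ * x) ≈ x
  ½-inverse x = ≈-trans (≈-sym (*-assoc _ _ _))
    (≈-trans (*-cong (*-inverseʳ 2≉0) ≈-refl) (*-identityˡ x))

  -- Follows from x⁻¹ = x (x⁻¹)², a product of nonnegative factors.
  ⁻¹-nonneg : ∀ {x} → 0# ≤ x → ¬ (x ≈ 0#) → 0# ≤ x ⁻¹
  ⁻¹-nonneg {x} 0≤x x≉0 = ≤-cong ≈-refl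
    (≈-trans (≈-sym (*-assoc x _ _)) (≈-trans (*-cong (*-inverseʳ x≉0) ≈-refl) (*-identityˡ _)))
    (*-nonneg 0≤x (*-square-nonneg (x ⁻¹)))

  √-nonneg : ∀ a → 0# ≤ √ a
  √-nonneg a with total 0# a
  ... | inj₁ 0≤a = proj₁ (proj₂ (sqrt a 0≤a))
  ... | inj₂ _   = ≤-refl

  √-square : ∀ {a} → 0# ≤ a → (√ a) ² ≈ a
  √-square {a} 0≤a with total 0# a
  ... | inj₁ 0≤a′ = proj₂ (proj₂ (sqrt a 0≤a′))
  -- Together with `0≤a` this branch forces a = 0, where the default value of `√_` is the correct
  -- root.
  ... | inj₂ a≤0  = ≈-trans (zeroʳ 0#) (antisym 0≤a a≤0)

  -- Absolute values.

  open Max totalOrder using (x≤y⇒x⊔y≈y; x≤y⇒y⊔x≈y)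

  x≤0⇒0≤-x : ∀ {x} → x ≤ 0# → 0# ≤ - x
  x≤0⇒0≤-x {x} x≤0 = ≤-cong (-‿inverseʳ x) (+-identityˡ _) (+-monoˡ-≤ (- x) x≤0)

  0≤x⇒-x≤0 : ∀ {x} → 0# ≤ x → - x ≤ 0#
  0≤x⇒-x≤0 {x} 0≤x = ≤-cong (+-identityˡ _) (-‿inverseʳ x) (+-monoˡ-≤ (- x) 0≤x)

  0≤x⇒∣x∣≈x : ∀ {x} → 0# ≤ x → ∣ x ∣ᵣ ≈ x
  0≤x⇒∣x∣≈x 0≤x = x≤y⇒y⊔x≈y (≤-trans (0≤x⇒-x≤0 0≤x) 0≤x)

  x≤0⇒∣x∣≈-x : ∀ {x} → x ≤ 0# → ∣ x ∣ᵣ ≈ - x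
  x≤0⇒∣x∣≈-x x≤0 = x≤y⇒x⊔y≈y (≤-trans x≤0 (x≤0⇒0≤-x x≤0))

  -x*-x≈x² : ∀ x → (- x) ² ≈ x ²
  -x*-x≈x² x = ≈-trans (≈-sym (-‿distribˡ-* x (- x)))
    (≈-trans (-‿cong (≈-sym (-‿distribʳ-* x x))) (-‿involutive (x ²)))

  x²≤0⇒x≈0 : ∀ {x} → x ² ≤ 0# → x ≈ 0#
  x²≤0⇒x≈0 {x} x²≤0 = antisym (bound x²≤0) (≤-cong ≈-refl (-‿involutive x)
    (x≤0⇒0≤-x (bound (≤-trans (≤-reflexive (-x*-x≈x² x)) x²≤0))))
    where
    bound : ∀ {y} → y ² ≤ 0# → y ≤ 0#
    bound y²≤0 = ²-cancel-≤ ≤-refl (≤-trans y²≤0 (≤-reflexive (≈-sym (zeroʳ 0#))))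

  ∣∣-nonneg : ∀ x → 0# ≤ ∣ x ∣ᵣ
  ∣∣-nonneg x with total 0# x
  ... | inj₁ 0≤x = ≤-trans 0≤x (≤-reflexive (≈-sym (0≤x⇒∣x∣≈x 0≤x)))
  ... | inj₂ x≤0 = ≤-trans (x≤0⇒0≤-x x≤0) (≤-reflexive (≈-sym (x≤0⇒∣x∣≈-x x≤0)))

  ∣x∣²≈x² : ∀ x → ∣ x ∣ᵣ ² ≈ x ²
  ∣x∣²≈x² x with total 0# x
  ... | inj₁ 0≤x = *-cong (0≤x⇒∣x∣≈x 0≤x) (0≤x⇒∣x∣≈x 0≤x)
  ... | inj₂ x≤0 = ≈-trans (*-cong (x≤0⇒∣x∣≈-x x≤0) (x≤0⇒∣x∣≈-x x≤0)) (-x*-x≈x² x)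

  -- The maximum inside `∣_∣ᵣ` is chosen by cases, so congruence is read off from the squares, which
  -- are ring expressions.
  ∣∣-cong : ∀ {x y} → x ≈ y → ∣ x ∣ᵣ ≈ ∣ y ∣ᵣ
  ∣∣-cong {x} {y} x≈y = antisym (le x≈y) (le (≈-sym x≈y))
    where
    le : ∀ {x y} → x ≈ y → ∣ x ∣ᵣ ≤ ∣ y ∣ᵣ
    le {x} {y} x≈y = ²-cancel-≤ (∣∣-nonneg y) (≤-reflexive
      (≈-trans (∣x∣²≈x² x) (≈-trans (*-cong x≈y x≈y) (≈-sym (∣x∣²≈x² y)))))

  x≤∣x∣ : ∀ x → x ≤ ∣ x ∣ᵣ
  x≤∣x∣ x with total 0# x
  ... | inj₁ 0≤x = ≤-reflexive (≈-sym (0≤x⇒∣x∣≈x 0≤x))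
  ... | inj₂ x≤0 = ≤-trans x≤0 (∣∣-nonneg x)

  -x≤∣x∣ : ∀ x → - x ≤ ∣ x ∣ᵣ
  -x≤∣x∣ x with total 0# x
  ... | inj₁ 0≤x = ≤-trans (0≤x⇒-x≤0 0≤x) (∣∣-nonneg x)
  ... | inj₂ x≤0 = ≤-reflexive (≈-sym (x≤0⇒∣x∣≈-x x≤0))

  -- The sign of `z` decides which of z = x - (x - z) and -z = -x + (x - z) is bounded term by term.
  ∣∣-triangle : ∀ x z → ∣ z ∣ᵣ ≤ ∣ x ∣ᵣ + ∣ x - z ∣ᵣ
  ∣∣-triangle x z with total 0# z
  ... | inj₁ 0≤z = ≤-cong
    (≈-trans (≈-trans (+-cong (≈-sym (≈-trans (+-comm z _) (x-y+y≈x x z))) ≈-refl)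
      (cancel z (x - z))) (≈-sym (0≤x⇒∣x∣≈x 0≤z))) ≈-refl
    (+-mono-≤ (x≤∣x∣ x) (-x≤∣x∣ (x - z)))
  ... | inj₂ z≤0 = ≤-cong
    (≈-trans (≈-trans (≈-sym (+-assoc (- x) x (- z))) (≈-trans
      (+-cong (≈-trans (+-comm (- x) x) (-‿inverseʳ x)) ≈-refl) (+-identityˡ (- z))))
      (≈-sym (x≤0⇒∣x∣≈-x z≤0))) ≈-refl
    (+-mono-≤ (-x≤∣x∣ x) (x≤∣x∣ (x - z)))

  -- Signs and conflicts along an edge.

  ofSign-square : ∀ s → ofSign s ² ≈ 1#
  ofSign-square Sign.+ = *-identityˡ 1#
  ofSign-square Sign.- = ≈-trans (-x*-x≈x² 1#) (*-identityˡ 1#)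

  ∣ofSign*∣ : ∀ s x → ∣ ofSign s * x ∣ᵣ ≈ ∣ x ∣ᵣ
  ∣ofSign*∣ s x = antisym
    (²-cancel-≤ (∣∣-nonneg x) (≤-reflexive squares))
    (²-cancel-≤ (∣∣-nonneg _) (≤-reflexive (≈-sym squares)))
    where
    squares : ∣ ofSign s * x ∣ᵣ ² ≈ ∣ x ∣ᵣ ²
    squares = ≈-trans (∣x∣²≈x² _) (≈-trans
      (solve 2 (λ s x → (s :* x) :* (s :* x) := (s :* s) :* (x :* x)) ≈-refl _ _)
      (≈-trans (*-cong (ofSign-square s) ≈-refl) (≈-trans (*-identityˡ _) (≈-sym (∣x∣²≈x² x)))))

  ofSign-*-cases : ∀ s t u → ofSign t * ofSign u ≈ ofSign s ⊎ ofSign t * ofSign u ≈ - ofSign s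
  ofSign-*-cases Sign.+ Sign.+ Sign.+ = inj₁ (*-identityˡ _)
  ofSign-*-cases Sign.+ Sign.+ Sign.- = inj₂ (*-identityˡ _)
  ofSign-*-cases Sign.+ Sign.- Sign.+ = inj₂ (*-identityʳ _)
  ofSign-*-cases Sign.+ Sign.- Sign.- = inj₁ (ofSign-square Sign.-)
  ofSign-*-cases Sign.- Sign.+ Sign.+ = inj₂ (≈-trans (*-identityˡ _) (≈-sym (-‿involutive 1#)))
  ofSign-*-cases Sign.- Sign.+ Sign.- = inj₁ (*-identityˡ _)
  ofSign-*-cases Sign.- Sign.- Sign.+ = inj₁ (*-identityʳ _)
  ofSign-*-cases Sign.- Sign.- Sign.- =
    inj₂ (≈-trans (ofSign-square Sign.-) (≈-sym (-‿involutive 1#)))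

  sign : Carrier → Sign
  sign x = Sum.[ (λ _ → Sign.+) , (λ _ → Sign.-) ] (total 0# x)

  sign-∣∣ : ∀ x → ofSign (sign x) * ∣ x ∣ᵣ ≈ x
  sign-∣∣ x with total 0# x
  ... | inj₁ 0≤x = ≈-trans (*-identityˡ _) (0≤x⇒∣x∣≈x 0≤x)
  ... | inj₂ x≤0 = ≈-trans (*-cong ≈-refl (x≤0⇒∣x∣≈-x x≤0)) (≈-trans (≈-sym (-‿distribˡ-* _ _))
    (≈-trans (-‿distribʳ-* _ _) (≈-trans (*-identityˡ _) (-‿involutive x))))

  -- Conflict is all or nothing, since `t * u` is `s` or its negative. The identity in the second
  -- case yields the value 2 at a = b = 1, and is used for absolute values in `sign-difference`.
  ofSign-difference : ∀ s t u →
    ∣ ofSign s - ofSign t * ofSign u ∣ᵣ ≈ 0# ⊎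
    (∣ ofSign s - ofSign t * ofSign u ∣ᵣ ≈ 2# ×
     ∀ a b → ofSign s * a - (ofSign t * ofSign u) * b ≈ ofSign s * (a + b))
  ofSign-difference s t u with ofSign-*-cases s t u
  ... | inj₁ tu≈s  = inj₁ (≈-trans
    (∣∣-cong (≈-trans (+-cong ≈-refl (-‿cong tu≈s)) (-‿inverseʳ _))) (0≤x⇒∣x∣≈x ≤-refl))
  ... | inj₂ tu≈-s = inj₂
    (≈-trans (∣∣-cong (≈-trans
        (+-cong (≈-sym (*-identityʳ _)) (-‿cong (≈-sym (*-identityʳ _)))) (expand 1# 1#)))
      (≈-trans (∣ofSign*∣ s 2#) (0≤x⇒∣x∣≈x 0≤2))
    , expand)
    where
    expand : ∀ a b → ofSign s * a - (ofSign t * ofSign u) * b ≈ ofSign s * (a + b)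
    expand a b = ≈-trans (+-cong ≈-refl (≈-trans (-‿cong (≈-trans (*-cong tu≈-s ≈-refl)
      (≈-sym (-‿distribˡ-* _ b)))) (-‿involutive _))) (≈-sym (distribˡ _ a b))

  ofSign-difference-≤2 : ∀ s t u → ∣ ofSign s - ofSign t * ofSign u ∣ᵣ ≤ 2#
  ofSign-difference-≤2 s t u with ofSign-difference s t u
  ... | inj₁ ≈0       = ≤-trans (≤-reflexive ≈0) 0≤2
  ... | inj₂ (≈2 , _) = ≤-reflexive ≈2

  -- Writing `x` and `y` as sign times absolute value, a conflict means that the two terms add
  -- without cancellation.
  sign-difference : ∀ t x y →
    ∣ ofSign (sign x) - ofSign t * ofSign (sign y) ∣ᵣ ≈ 0# ⊎
    (∣ ofSign (sign x) - ofSign t * ofSign (sign y) ∣ᵣ ≈ 2# ×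
     ∣ x - ofSign t * y ∣ᵣ ≈ ∣ x ∣ᵣ + ∣ y ∣ᵣ)
  sign-difference t x y with ofSign-difference (sign x) t (sign y)
  ... | inj₁ ≈0            = inj₁ ≈0
  ... | inj₂ (≈2 , expand) = inj₂ (≈2 , ≈-trans
    (∣∣-cong (≈-trans (+-cong (≈-sym (sign-∣∣ x)) (-‿cong (≈-trans
      (*-cong ≈-refl (≈-sym (sign-∣∣ y))) (≈-sym (*-assoc _ _ _))))) (expand _ _)))
    (≈-trans (∣ofSign*∣ (sign x) _) (0≤x⇒∣x∣≈x (+-nonneg (∣∣-nonneg x) (∣∣-nonneg y)))))

  -- Natural numbers in the field, finite sums, suprema and minima.

  ofℕ-nonneg : ∀ m → 0# ≤ ofℕ m
  ofℕ-nonneg zero    = ≤-refl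
  ofℕ-nonneg (suc m) = +-nonneg 0≤1 (ofℕ-nonneg m)

  ofℕ≉0 : ∀ {m} → 1 ≤ℕ m → ¬ (ofℕ m ≈ 0#)
  ofℕ≉0 {suc m} _ p = 0≉1 (≈-sym (0≤x+y≈0⇒x≈0 0≤1 (ofℕ-nonneg m) p))

  module _ {a} {A : Set a} where

    ∑-cong : ∀ xs {f g : A → Carrier} → (∀ {x} → x ∈ xs → f x ≈ g x) → ∑ xs f ≈ ∑ xs g
    ∑-cong []       f≈g = ≈-refl
    ∑-cong (x ∷ xs) f≈g = +-cong (f≈g (here refl)) (∑-cong xs (f≈g ∘ there))

    ∑-mono : ∀ xs {f g : A → Carrier} → (∀ {x} → x ∈ xs → f x ≤ g x) → ∑ xs f ≤ ∑ xs g
    ∑-mono []       f≤g = ≤-refl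
    ∑-mono (x ∷ xs) f≤g = +-mono-≤ (f≤g (here refl)) (∑-mono xs (f≤g ∘ there))

    ∑-zero : ∀ xs → ∑ xs (λ (_ : A) → 0#) ≈ 0#
    ∑-zero []       = ≈-refl
    ∑-zero (x ∷ xs) = ≈-trans (+-identityˡ _) (∑-zero xs)

    ∑-nonneg : ∀ xs {f : A → Carrier} → (∀ {x} → x ∈ xs → 0# ≤ f x) → 0# ≤ ∑ xs f
    ∑-nonneg xs 0≤f = ≤-cong (∑-zero xs) ≈-refl (∑-mono xs 0≤f)

    ∑-+ : ∀ xs (f g : A → Carrier) → ∑ xs (λ x → f x + g x) ≈ ∑ xs f + ∑ xs g
    ∑-+ []       f g = ≈-sym (+-identityˡ 0#)
    ∑-+ (x ∷ xs) f g = ≈-trans (+-cong ≈-refl (∑-+ xs f g))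
      (solve 4 (λ a b s t → (a :+ b) :+ (s :+ t) := (a :+ s) :+ (b :+ t)) ≈-refl _ _ _ _)

    ∑-* : ∀ xs z (f : A → Carrier) → ∑ xs (λ x → z * f x) ≈ z * ∑ xs f
    ∑-* []       z f = ≈-sym (zeroʳ z)
    ∑-* (x ∷ xs) z f = ≈-trans (+-cong ≈-refl (∑-* xs z f)) (≈-sym (distribˡ z _ _))

    ∑-++ : ∀ xs ys (f : A → Carrier) → ∑ (xs ++ ys) f ≈ ∑ xs f + ∑ ys f
    ∑-++ []       ys f = ≈-sym (+-identityˡ _)
    ∑-++ (x ∷ xs) ys f = ≈-trans (+-cong ≈-refl (∑-++ xs ys f)) (≈-sym (+-assoc _ _ _))

    term≤∑ : ∀ xs {f : A → Carrier} → (∀ {x} → x ∈ xs → 0# ≤ f x) →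
             ∀ {x} → x ∈ xs → f x ≤ ∑ xs f
    term≤∑ (x ∷ xs) 0≤f (here refl) = x≤x+d (∑-nonneg xs (0≤f ∘ there))
    term≤∑ (y ∷ xs) 0≤f (there x∈xs) = ≤-trans (term≤∑ xs (0≤f ∘ there) x∈xs)
      (≤-cong ≈-refl (+-comm _ _) (x≤x+d (0≤f (here refl))))

    ofℕ-length : ∀ (xs : List A) → ofℕ (length xs) ≈ ∑ xs (λ _ → 1#)
    ofℕ-length []       = ≈-refl
    ofℕ-length (x ∷ xs) = +-cong ≈-refl (ofℕ-length xs)

    module _ {p} {P : Pred A p} (P? : Decidable P) where

      ∑-filter : ∀ xs (f : A → Carrier) →
                 ∑ (filter P? xs) f ≈ ∑ xs (λ x → if does (P? x) then f x else 0#)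
      ∑-filter []       f = ≈-refl
      ∑-filter (x ∷ xs) f with does (P? x)
      ... | true  = +-cong ≈-refl (∑-filter xs f)
      ... | false = ≈-trans (∑-filter xs f) (≈-sym (+-identityˡ _))

      ∑-filter-≤ : ∀ xs {f g : A → Carrier} → (∀ x → P x → f x ≤ g x) → (∀ x → 0# ≤ g x) →
                   ∑ (filter P? xs) f ≤ ∑ xs g
      ∑-filter-≤ xs {f} {g} f≤g 0≤g =
        ≤-trans (≤-reflexive (∑-filter xs f)) (∑-mono xs (λ {x} _ → termwise x))
        where
        termwise : ∀ x → (if does (P? x) then f x else 0#) ≤ g x
        termwise x with P? x
        ... | yes px = f≤g x px
        ... | no  _  = 0≤g x

    sup₀-nonneg : ∀ xs (f : A → Carrier) → 0# ≤ sup₀ xs f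
    sup₀-nonneg xs f = Extrema.⊥≤max totalOrder 0# (map f xs)

    sup₀-upper : ∀ xs (f : A → Carrier) {x} → x ∈ xs → f x ≤ sup₀ xs f
    sup₀-upper xs f x∈xs =
      All.lookup (Extrema.xs≤max totalOrder 0# (map f xs)) (∈-map⁺ f x∈xs)

    sup₀-least : ∀ xs (f : A → Carrier) {v} → 0# ≤ v → (∀ {x} → x ∈ xs → f x ≤ v) → sup₀ xs f ≤ v
    sup₀-least xs f 0≤v f≤v =
      Extrema.max≤v⁺ totalOrder 0≤v (All.map⁺ (All.tabulate f≤v))

    minimum-lower : ∀ x xs (f : A → Carrier) {y} → y ∈ xs → minimum x xs f ≤ f y
    minimum-lower x xs f y∈xs =
      All.lookup (Extrema.min≤xs totalOrder (f x) (map f xs)) (∈-map⁺ f y∈xs)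

    minimum-greatest : ∀ x xs (f : A → Carrier) {v} → v ≤ f x → (∀ {y} → y ∈ xs → v ≤ f y) →
                       v ≤ minimum x xs f
    minimum-greatest x xs f v≤fx v≤f =
      Extrema.v≤min⁺ totalOrder v≤fx (All.map⁺ (All.tabulate v≤f))

  ∑-map : ∀ {a b} {A : Set a} {B : Set b} (h : A → B) xs (f : B → Carrier) →
          ∑ (map h xs) f ≡ ∑ xs (f ∘ h)
  ∑-map h []       f = refl
  ∑-map h (x ∷ xs) f = cong (f (h x) +_) (∑-map h xs f)

  ∑-swap : ∀ {a b} {A : Set a} {B : Set b} xs ys (F : A → B → Carrier) →
           ∑ xs (λ x → ∑ ys (F x)) ≈ ∑ ys (λ y → ∑ xs (λ x → F x y))
  ∑-swap []       ys F = ≈-sym (∑-zero ys)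
  ∑-swap (x ∷ xs) ys F = ≈-trans (+-cong ≈-refl (∑-swap xs ys F)) (≈-sym (∑-+ ys _ _))

  -- Layer-cake summation, with `above t v` the indicator [v > t] and `excess t v` the positive part
  -- (v - t)⁺.

  above excess : Carrier → Carrier → Carrier
  above  t v = if does (v ≤? t) then 0# else 1#
  excess t v = if does (v ≤? t) then 0# else v - t

  above-nonneg : ∀ t v → 0# ≤ above t v
  above-nonneg t v with v ≤? t
  ... | yes _ = ≤-refl
  ... | no  _ = 0≤1

  above-mono : ∀ t {v w} → v ≤ w → above t v ≤ above t w
  above-mono t {v} {w} v≤w with v ≤? t | w ≤? t
  ... | yes _   | yes _   = ≤-refl
  ... | yes _   | no  _   = 0≤1
  ... | no  v≰t | yes w≤t = contradiction (≤-trans v≤w w≤t) v≰t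
  ... | no  _   | no  _   = ≤-refl

  above-one : ∀ {t v} → ¬ (v ≤ t) → above t v ≈ 1#
  above-one {t} {v} v≰t with v ≤? t
  ... | yes v≤t = contradiction v≤t v≰t
  ... | no  _   = ≈-refl

  excess-below : ∀ {t v} → v ≤ t → excess t v ≈ 0#
  excess-below {t} {v} v≤t with v ≤? t
  ... | yes _   = ≈-refl
  ... | no  v≰t = contradiction v≤t v≰t

  excess-zero : ∀ {v} → 0# ≤ v → excess 0# v ≈ v
  excess-zero {v} 0≤v with v ≤? 0#
  ... | yes v≤0 = antisym 0≤v v≤0
  ... | no  _   = ≈-trans (+-cong (≈-sym (+-identityʳ v)) ≈-refl) (cancel v 0#)

  -- As a function of the level, (v - t)⁺ is linear away from its kink at `v`; the gap hypothesis
  -- keeps the kink out of the open interval from `t` to `b`.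
  excess-step : ∀ {t b v} → t ≤ b → v ≤ t ⊎ b ≤ v →
                excess t v ≈ excess b v + (b - t) * above t v
  excess-step {t} {b} {v} t≤b gap with v ≤? t | v ≤? b
  ... | yes _   | yes _   = ≈-sym (≈-trans (+-identityˡ _) (zeroʳ _))
  ... | yes v≤t | no  v≰b = contradiction (≤-trans v≤t t≤b) v≰b
  ... | no  v≰t | yes v≤b with gap
  ...   | inj₁ v≤t = contradiction v≤t v≰t
  ...   | inj₂ b≤v = ≈-trans (+-cong (antisym v≤b b≤v) ≈-refl)
                       (≈-sym (≈-trans (+-identityˡ _) (*-identityʳ _)))
  excess-step {t} {b} {v} t≤b gap | no _ | no _ =
    ≈-trans (+-cong (≈-sym (x-y+y≈x v b)) ≈-refl)
      (≈-trans (+-assoc _ _ _) (+-cong ≈-refl (≈-sym (*-identityʳ _))))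

  -- Each pair consists of a coefficient and a value. The function `φ` is the identity, a level
  -- indicator or a positive part.
  weigh : List (Carrier × Carrier) → (Carrier → Carrier) → Carrier
  weigh ps φ = ∑ ps (λ p → proj₁ p * φ (proj₂ p))

  -- The layer-cake principle v = ∫₀^∞ [v > t] dt, without integrals: between two consecutive
  -- values occurring in the sums, Σ c (v - t)⁺ decreases in t at the constant rate Σ c [v > t].
  layerCake : ∀ ps qs → All (λ p → 0# ≤ proj₂ p) (ps ++ qs) →
              (∀ t → 0# ≤ t → weigh ps (above t) ≤ weigh qs (above t)) →
              weigh ps id ≤ weigh qs id
  layerCake ps qs 0≤v level = ≤-cong
      (∑-cong ps (λ p∈ps → *-cong ≈-refl (excess-zero (All.lookup 0≤v (∈-++⁺ˡ p∈ps)))))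
      (∑-cong qs (λ q∈qs → *-cong ≈-refl (excess-zero (All.lookup 0≤v (∈-++⁺ʳ ps q∈qs)))))
      -- The descent starts at level 0, where the excess of a nonnegative value is the value itself;
      -- the breakpoints are all values of both lists.
      (descend (sort values) 0# ≤-refl
        (All.tabulate nonneg ∷ Sorted⇒AllPairs totalOrder (sort-↗ values))
        (λ p∈ → inj₂ (∈-resp-↭ (↭-sym (sort-↭ values)) (∈-map⁺ proj₂ p∈))))
    where
    open Sort decTotalOrder using (sort; sort-↗; sort-↭)

    values : List Carrier
    values = map proj₂ (ps ++ qs)

    nonneg : ∀ {v} → v ∈ sort values → 0# ≤ v
    nonneg v∈ = All.lookup (All.map⁺ 0≤v) (∈-resp-↭ (sort-↭ values) v∈)

    vanish : ∀ rs {t} → (∀ {p} → p ∈ rs → proj₂ p ≤ t ⊎ proj₂ p ∈ []) →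
             weigh rs (excess t) ≈ 0#
    vanish rs {t} below = ≈-trans (∑-cong rs (λ p∈rs → zero-term (below p∈rs))) (∑-zero rs)
      where
      zero-term : ∀ {p : Carrier × Carrier} → proj₂ p ≤ t ⊎ proj₂ p ∈ [] →
                  proj₁ p * excess t (proj₂ p) ≈ 0#
      zero-term (inj₁ v≤t) = ≈-trans (*-cong ≈-refl (excess-below v≤t)) (zeroʳ _)

    split : ∀ rs {t b bs} → t ≤ b → All (b ≤_) bs →
            (∀ {p} → p ∈ rs → proj₂ p ≤ t ⊎ proj₂ p ∈ b ∷ bs) →
            weigh rs (excess t) ≈ weigh rs (excess b) + (b - t) * weigh rs (above t)
    split rs {t} {b} {bs} t≤b b≤bs cover = ≈-trans
      (∑-cong rs (λ p∈rs → ≈-trans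
        (*-cong ≈-refl (excess-step t≤b (Sum.map id above-b (cover p∈rs))))
        (solve 4 (λ c e d a → c :* (e :+ d :* a) := c :* e :+ d :* (c :* a)) ≈-refl _ _ _ _)))
      (≈-trans (∑-+ rs _ _) (+-cong ≈-refl (∑-* rs _ _)))
      where
      above-b : ∀ {v} → v ∈ b ∷ bs → b ≤ v
      above-b = All.lookup (≤-refl ∷ b≤bs)

    -- Induction on the breakpoints still above `t`. Every value is either at most `t` or still
    -- listed, so none lies strictly between `t` and the next breakpoint, and past the last one both
    -- sides vanish.
    descend : ∀ bs t → 0# ≤ t → AllPairs _≤_ (t ∷ bs) →
              (∀ {p} → p ∈ ps ++ qs → proj₂ p ≤ t ⊎ proj₂ p ∈ bs) →
              weigh ps (excess t) ≤ weigh qs (excess t)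
    descend [] t 0≤t _ cover = ≤-reflexive
      (≈-trans (vanish ps (cover ∘ ∈-++⁺ˡ)) (≈-sym (vanish qs (cover ∘ ∈-++⁺ʳ ps))))
    descend (b ∷ bs) t 0≤t ((t≤b ∷ _) ∷ sorted@(b≤bs ∷ _)) cover = ≤-cong
      (≈-sym (split ps t≤b b≤bs (cover ∘ ∈-++⁺ˡ)))
      (≈-sym (split qs t≤b b≤bs (cover ∘ ∈-++⁺ʳ ps)))
      (+-mono-≤ (descend bs b (≤-trans 0≤t t≤b) sorted (next ∘ cover))
        (*-monoʳ-≤ (x≤y⇒0≤y-x t≤b) (level t 0≤t)))
      where
      next : ∀ {v} → v ≤ t ⊎ v ∈ b ∷ bs → v ≤ b ⊎ v ∈ bs
      next (inj₁ v≤t)           = inj₁ (≤-trans v≤t t≤b)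
      next (inj₂ (here refl))   = inj₁ ≤-refl
      next (inj₂ (there v∈bs))  = inj₂ v∈bs

  -- Stated for `List.tabulate g` to make the induction go through: the tail is tabulated by
  -- `g ∘ suc`. Taking `g = id` gives the list of vertices.
  ofℕ-∣∣ : ∀ {a n} {A : Set a} (g : Fin n → A) (V : Subset n) (φ : A → Carrier) →
           (∀ i → φ (g i) ≈ (if lookup V i then 1# else 0#)) → ofℕ ∣ V ∣ ≈ ∑ (List.tabulate g) φ
  ofℕ-∣∣ g []          φ φ≈ = ≈-refl
  ofℕ-∣∣ g (true ∷ V)  φ φ≈ = +-cong (≈-sym (φ≈ zero)) (ofℕ-∣∣ (g ∘ suc) V φ (φ≈ ∘ suc))
  ofℕ-∣∣ g (false ∷ V) φ φ≈ = ≈-trans (ofℕ-∣∣ (g ∘ suc) V φ (φ≈ ∘ suc))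
    (≈-trans (≈-sym (+-identityˡ _)) (+-cong (≈-sym (φ≈ zero)) ≈-refl))

  -- The number κ = √(1+h) - 1 for 0 ≤ h ≤ 2.

  module _ {h} (0≤h : 0# ≤ h) (h≤2 : h ≤ 2#) where

    private
      r κ : Carrier
      r = √ (1# + h)
      κ = r - 1#

      r²≈1+h : r ² ≈ 1# + h
      r²≈1+h = √-square (+-nonneg 0≤1 0≤h)

      κ+1≈r : κ + 1# ≈ r
      κ+1≈r = x-y+y≈x r 1#

    √[1+h]-1-nonneg : 0# ≤ κ
    √[1+h]-1-nonneg = x≤y⇒0≤y-x (²-cancel-≤ (√-nonneg _)
      (≤-cong (≈-sym (*-identityˡ 1#)) (≈-sym r²≈1+h) (x≤x+d 0≤h)))

    √[1+h]-1-square : (κ + 1#) ² ≈ 1# + h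
    √[1+h]-1-square = ≈-trans (*-cong κ+1≈r κ+1≈r) r²≈1+h

    -- Since h ≤ 2, the square of κ + 1 is at most 3, hence at most 2².
    √[1+h]-1-≤1 : κ ≤ 1#
    √[1+h]-1-≤1 = +-cancelʳ-≤ 1# (≤-cong (≈-sym κ+1≈r) ≈-refl (²-cancel-≤ 0≤2 (begin
      r ²            ≈⟨ r²≈1+h ⟩
      1# + h         ≤⟨ +-monoʳ-≤ 1# h≤2 ⟩
      1# + 2#        ≤⟨ +-monoˡ-≤ 2# 1≤2 ⟩
      2# + 2#        ≈⟨ solve 0 ((con 1 :+ con 1) :+ (con 1 :+ con 1)
                                  := (con 1 :+ con 1) :* (con 1 :+ con 1)) ≈-refl ⟩
      2# ²           ∎)))

    -- With ρ = 1 - κ this is (2 - κ)² - 2 κ = 2 (1 - κ)² + (2 - h), where h = κ² + 2 κ.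
    √[1+h]-1-gap : ∀ {ρ} → 1# ≈ κ + ρ → 2# * κ ≤ (1# + ρ) ²
    √[1+h]-1-gap {ρ} 1≈κ+ρ = +-cancelʳ-≤ (1# + h) (begin
      2# * κ + (1# + h)                    ≤⟨ +-monoʳ-≤ _ (+-monoʳ-≤ 1# h≤2) ⟩
      2# * κ + (1# + 2#)                   ≤⟨ x≤x+d (*-nonneg 0≤2 (*-square-nonneg ρ)) ⟩
      2# * κ + (1# + 2#) + 2# * ρ ²        ≈⟨ homogenise ⟩
      (1# + ρ) ² + (κ + 1#) ²              ≈⟨ +-cong ≈-refl √[1+h]-1-square ⟩
      (1# + ρ) ² + (1# + h)                ∎)
      where
      -- Replacing 1 by κ + ρ makes both sides the quadratic form 5κ² + 8κρ + 5ρ², which the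
      -- semiring solver can verify.
      homogenise : 2# * κ + (1# + 2#) + 2# * ρ ² ≈ (1# + ρ) ² + (κ + 1#) ²
      homogenise = ≈-trans
        (+-cong (+-cong (≈-trans (solve 1 (λ κ → (con 1 :+ con 1) :* κ
                                              := (con 1 :+ con 1) :* (κ :* con 1)) ≈-refl κ)
                                 (*-cong ≈-refl (*-cong ≈-refl 1≈κ+ρ)))
                        (≈-trans (solve 0 (con 1 :+ (con 1 :+ con 1)
                                   := (con 1 :+ con 1 :+ con 1) :* (con 1 :* con 1)) ≈-refl)
                                 (*-cong ≈-refl (*-cong 1≈κ+ρ 1≈κ+ρ)))) ≈-refl)
        (≈-trans (solve 2 (λ κ ρ →
           (con 1 :+ con 1) :* (κ :* (κ :+ ρ))
             :+ (con 1 :+ con 1 :+ con 1) :* ((κ :+ ρ) :* (κ :+ ρ))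
             :+ (con 1 :+ con 1) :* (ρ :* ρ)
           := ((κ :+ ρ) :+ ρ) :* ((κ :+ ρ) :+ ρ) :+ (κ :+ (κ :+ ρ)) :* (κ :+ (κ :+ ρ))) ≈-refl κ ρ)
         (+-cong (*-cong 1+ρ 1+ρ) (*-cong κ+1 κ+1)))
        where
        1+ρ : (κ + ρ) + ρ ≈ 1# + ρ
        1+ρ = +-cong (≈-sym 1≈κ+ρ) ≈-refl
        κ+1 : κ + (κ + ρ) ≈ κ + 1#
        κ+1 = +-cong ≈-refl (≈-sym 1≈κ+ρ)

  -- The pointwise inequality between a, s and the threshold b.

  module _ {κ ρ} (0≤κ : 0# ≤ κ) (0≤ρ : 0# ≤ ρ) (1≈κ+ρ : 1# ≈ κ + ρ)
           (gap : 2# * κ ≤ (1# + ρ) ²) where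

    private
      -- The hypothesis is (s - κa)² ≥ 2κb² written without subtraction; adding κ(a² + s²) to both
      -- sides gives the conclusion.
      tradeoff : ∀ {a s b} → 2# * κ * b ² + 2# * (κ * a * s) ≤ s ² + (κ * a) ² →
                 κ * (2# * b ² + (a + s) ²) ≤ (κ + 1#) * s ² + (κ * (κ + 1#)) * a ²
      tradeoff {a} {s} {b} p = ≤-cong
        (solve 4 (λ κ a s b → ((con 1 :+ con 1) :* κ :* (b :* b) :+ (con 1 :+ con 1) :* (κ :* a :* s))
                    :+ κ :* (a :* a :+ s :* s)
                    := κ :* ((con 1 :+ con 1) :* (b :* b) :+ (a :+ s) :* (a :+ s))) ≈-refl κ a s b)
        (solve 3 (λ κ a s → (s :* s :+ (κ :* a) :* (κ :* a)) :+ κ :* (a :* a :+ s :* s)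
                    := (κ :+ con 1) :* (s :* s) :+ (κ :* (κ :+ con 1)) :* (a :* a)) ≈-refl κ a s)
        (+-monoˡ-≤ (κ * (a ² + s ²)) p)

      x≈κx+ρx : ∀ x → x ≈ κ * x + ρ * x
      x≈κx+ρx x = ≈-trans (≈-sym (*-identityˡ x)) (≈-trans (*-cong 1≈κ+ρ ≈-refl)
        (solve 3 (λ κ ρ x → (κ :+ ρ) :* x := κ :* x :+ ρ :* x) ≈-refl κ ρ x))

      -- Here g = s - κa equals ρa + e, which is at least (1 + ρ)b because `b` is below both `a` and
      -- `e`. By `gap`, 2κb² ≤ (1 + ρ)²b² ≤ g².
      tradeoff-split : ∀ {a s b e} → 0# ≤ b → b ≤ a → b ≤ e → s ≈ a + e →
                       2# * κ * b ² + 2# * (κ * a * s) ≤ s ² + (κ * a) ²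
      tradeoff-split {a} {s} {b} {e} 0≤b b≤a b≤e s≈a+e = begin
        2# * κ * b ² + 2# * (κ * a * s)
          ≤⟨ +-monoˡ-≤ _ (*-monoˡ-≤ (*-square-nonneg b) gap) ⟩
        (1# + ρ) ² * b ² + 2# * (κ * a * s)
          ≈⟨ +-cong (solve 2 (λ u b → (u :* u) :* (b :* b) := (u :* b) :* (u :* b)) ≈-refl (1# + ρ) b)
                    (*-cong ≈-refl (*-cong ≈-refl s≈κa+g)) ⟩
        ((1# + ρ) * b) ² + 2# * (κ * a * (κ * a + g))
          ≤⟨ +-monoˡ-≤ _ (²-mono-≤ (*-nonneg (+-nonneg 0≤1 0≤ρ) 0≤b) g-bound) ⟩
        g ² + 2# * (κ * a * (κ * a + g))
          ≈⟨ solve 2 (λ k g → g :* g :+ (con 1 :+ con 1) :* (k :* (k :+ g))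
                              := (k :+ g) :* (k :+ g) :+ k :* k) ≈-refl (κ * a) g ⟩
        (κ * a + g) ² + (κ * a) ²
          ≈⟨ +-cong (*-cong (≈-sym s≈κa+g) (≈-sym s≈κa+g)) ≈-refl ⟩
        s ² + (κ * a) ² ∎
        where
        g : Carrier
        g = ρ * a + e
        s≈κa+g : s ≈ κ * a + g
        s≈κa+g = ≈-trans s≈a+e (≈-trans (+-cong (x≈κx+ρx a) ≈-refl) (+-assoc _ _ _))
        g-bound : (1# + ρ) * b ≤ g
        g-bound = ≤-cong
          (solve 2 (λ ρ b → ρ :* b :+ b := (con 1 :+ ρ) :* b) ≈-refl ρ b) ≈-refl
          (+-mono-≤ (*-monoʳ-≤ 0≤ρ b≤a) b≤e)

    -- The threshold is max 0 (min a (s - a)).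
    frustrationThreshold : ∀ {a s} → 0# ≤ a → 0# ≤ s →
      ∃ λ b → 0# ≤ b ×
        κ * (2# * b ² + (a + s) ²) ≤ (κ + 1#) * s ² + (κ * (κ + 1#)) * a ² ×
        (∀ v → a + v ≤ s → a ≤ b ⊎ v ≤ b)
    frustrationThreshold {a} {s} 0≤a 0≤s with total s a
    -- When s ≤ a the threshold is 0: a + v ≤ s forces v ≤ 0, and the required bound is just (s -
    -- κa)² ≥ 0.
    ... | inj₁ s≤a = 0# , ≤-refl , tradeoff bound , λ v a+v≤s → inj₂
        (+-cancelʳ-≤ a (≤-cong (+-comm a v) (≈-sym (+-identityˡ a)) (≤-trans a+v≤s s≤a)))
      where
      bound : 2# * κ * 0# ² + 2# * (κ * a * s) ≤ s ² + (κ * a) ²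
      bound = ≤-cong
        (≈-trans
          (solve 2 (λ k s → k :* s :+ k :* s := con 0 :+ (con 1 :+ con 1) :* (k :* s))
            ≈-refl (κ * a) s)
          (+-cong (≈-sym (≈-trans (*-cong ≈-refl (zeroʳ 0#)) (zeroʳ _))) ≈-refl))
        (+-comm _ _) (amgm s (κ * a))
    ... | inj₂ a≤s with difference a≤s
    ...   | e , 0≤e , s≈a+e with total a e
    ...     | inj₁ a≤e = a , 0≤a , tradeoff (tradeoff-split 0≤a ≤-refl a≤e s≈a+e) , λ _ _ → inj₁ ≤-refl
    ...     | inj₂ e≤a = e , 0≤e , tradeoff (tradeoff-split 0≤e e≤a ≤-refl s≈a+e) , λ v a+v≤s → inj₂
                (+-cancelʳ-≤ a (≤-cong (+-comm a v) (≈-trans s≈a+e (+-comm a e)) a+v≤s))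

∈-allVecs : ∀ {a} {A : Set a} {xs : List A} → (∀ x → x ∈ xs) →
            ∀ {n} (v : Vec A n) → v ∈ allVecs xs n
∈-allVecs all []      = here refl
∈-allVecs all (x ∷ v) = ∈-cartesianProductWith⁺ _∷_ (all x) (∈-allVecs all v)

module SignedGraphInequalities
  {c ℓ₁ ℓ₂} (ℝ : CompleteOrderedField c ℓ₁ ℓ₂) {n : ℕ} (G : Graph n) (S : Signature G) where

  open CompleteOrderedField ℝ
  open RealOperations ℝ
  open OrderedFieldProperties ℝ
  open SignedGraphConstants ℝ G S
  open Graph G
  open Signature S

  -- Summation by parts and the upper bound.

  difference-along : (Fin n → Carrier) → Fin n → Fin n → Carrier
  difference-along f x y = f x - ofSign (σ x y) * f y

  ∈-neighbours : ∀ {x y} → y ∼ x → y ∈ neighbours x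
  ∈-neighbours {x} {y} = ∈-filter⁺ (_∼? x) (∈-allFin y)

  neighbours-∼ : ∀ {x y} → y ∈ neighbours x → y ∼ x
  neighbours-∼ {x} = proj₂ ∘ ∈-filter⁻ (_∼? x) {xs = allFin n}

  -- Both sides run over ordered adjacent pairs. Turning neighbour lists into indicators over all
  -- vertices reduces the claim to `∑-swap` and the symmetry of adjacency.
  ∑-neighbours-swap : ∀ (F : Fin n → Fin n → Carrier) →
    ∑ vertices (λ x → ∑ (neighbours x) (λ y → F y x)) ≈ ∑ vertices (λ x → ∑ (neighbours x) (F x))
  ∑-neighbours-swap F = begin-equality
    ∑ vertices (λ x → ∑ (neighbours x) (λ y → F y x))
      ≈⟨ ∑-cong vertices (λ {x} _ → ∑-filter (_∼? x) vertices _) ⟩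
    ∑ vertices (λ x → ∑ vertices (λ y → if does (y ∼? x) then F y x else 0#))
      ≈⟨ ∑-swap vertices vertices _ ⟩
    ∑ vertices (λ y → ∑ vertices (λ x → if does (y ∼? x) then F y x else 0#))
      ≈⟨ ∑-cong vertices (λ {y} _ → ∑-cong vertices (λ {x} _ → flip-edge y x)) ⟩
    ∑ vertices (λ y → ∑ vertices (λ x → if does (x ∼? y) then F y x else 0#))
      ≈⟨ ∑-cong vertices (λ {y} _ → ∑-filter (_∼? y) vertices _) ⟨
    ∑ vertices (λ y → ∑ (neighbours y) (F y)) ∎
    where
    flip-edge : ∀ y x → (if does (y ∼? x) then F y x else 0#) ≈
                        (if does (x ∼? y) then F y x else 0#)
    flip-edge y x with y ∼? x | x ∼? y
    ... | yes _   | yes _   = ≈-refl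
    ... | yes y∼x | no  x≁y = contradiction (∼-sym y∼x) x≁y
    ... | no  y≁x | yes x∼y = contradiction (∼-sym x∼y) y≁x
    ... | no  _   | no  _   = ≈-refl

  -- The expansion uses ε² = 1 and the symmetry of σ on edges. Taking -ε as the solver variable
  -- removes the subtractions.
  difference-square : ∀ f {x y} → y ∼ x →
    difference-along f x y ² ≈ f x * difference-along f x y + f y * difference-along f y x
  difference-square f {x} {y} y∼x = begin-equality
    (f x - ε * f y) ²
      ≈⟨ *-cong (move (f x) (f y)) (move (f x) (f y)) ⟩
    (f x + - ε * f y) ²
      ≈⟨ solve 3 (λ p q e → (p :+ e :* q) :* (p :+ e :* q)
                   := p :* (p :+ e :* q) :+ q :* ((e :* e) :* q :+ e :* p)) ≈-refl (f x) (f y) (- ε) ⟩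
    f x * (f x + - ε * f y) + f y * ((- ε) ² * f y + - ε * f x)
      ≈⟨ +-cong (*-cong ≈-refl (≈-sym (move _ _))) (*-cong ≈-refl (≈-trans
           (+-cong (≈-trans (*-cong (≈-trans (-x*-x≈x² ε) (ofSign-square (σ x y))) ≈-refl)
             (*-identityˡ _)) ≈-refl) (≈-sym (move _ _)))) ⟩
    f x * (f x - ε * f y) + f y * (f y - ε * f x)
      ≡⟨ cong (λ s → f x * (f x - ε * f y) + f y * (f y - ofSign s * f x)) (σ-sym (∼-sym y∼x)) ⟩
    f x * difference-along f x y + f y * difference-along f y x ∎
    where
    ε : Carrier
    ε = ofSign (σ x y)
    move : ∀ p q → p - ε * q ≈ p + - ε * q
    move p q = +-cong ≈-refl (-‿distribˡ-* ε q)

  -- Green's formula: the two terms of `difference-square` have the same sum over ordered adjacent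
  -- pairs.
  ∑-difference-square : ∀ f →
    ∑ vertices (λ x → ∑ (neighbours x) (λ y → difference-along f x y ²)) ≈
    2# * ∑ vertices (λ x → f x * ∑ (neighbours x) (difference-along f x))
  ∑-difference-square f = begin-equality
    ∑ vertices (λ x → ∑ (neighbours x) (λ y → difference-along f x y ²))
      ≈⟨ ∑-cong vertices (λ {x} _ → ≈-trans
           (∑-cong (neighbours x) (λ y∈ → difference-square f (neighbours-∼ y∈)))
           (∑-+ (neighbours x) _ _)) ⟩
    ∑ vertices (λ x → ∑ (neighbours x) (F x) + ∑ (neighbours x) (λ y → F y x))
      ≈⟨ ∑-+ vertices _ _ ⟩
    E + ∑ vertices (λ x → ∑ (neighbours x) (λ y → F y x))
      ≈⟨ +-cong ≈-refl (∑-neighbours-swap F) ⟩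
    E + E
      ≈⟨ solve 1 (λ e → e :+ e := (con 1 :+ con 1) :* e) ≈-refl E ⟩
    2# * E
      ≈⟨ *-cong ≈-refl (∑-cong vertices (λ {x} _ → ∑-* (neighbours x) (f x) _)) ⟩
    2# * ∑ vertices (λ x → f x * ∑ (neighbours x) (difference-along f x)) ∎
    where
    F : Fin n → Fin n → Carrier
    F x y = f x * difference-along f x y
    E : Carrier
    E = ∑ vertices (λ x → ∑ (neighbours x) (F x))

  -- The eigenfunction serves as test function, and its nonzero energy is then divided out; no
  -- extremality of `μ` or `ν` enters.
  poincaré≤eigenvalue : ∀ {d} → 1 ≤ℕ d → ∀ {μ ν} → IsEigenvalue d μ → IsPoincaréConstant ν →
                        ν ≤ 2# * ofℕ d * μ
  poincaré≤eigenvalue {d} 1≤d {μ} {ν} (f , (x₀ , fx₀≉0) , Δf≈μf) poincaré =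
    *-cancelˡ-≤ (∑-nonneg vertices (λ _ → *-square-nonneg _)) energy≉0
      (≤-cong (*-comm _ _) (*-comm _ _) (begin
    ν * energy
      ≤⟨ poincaré f ⟩
    ∑ vertices (λ x → sup₀ (neighbours x) (λ y → ∣ difference-along f x y ∣ᵣ ²))
      ≤⟨ ∑-mono vertices (λ {x} _ → sup≤∑ x) ⟩
    ∑ vertices (λ x → ∑ (neighbours x) (λ y → difference-along f x y ²))
      ≈⟨ ∑-difference-square f ⟩
    2# * ∑ vertices (λ x → f x * ∑ (neighbours x) (difference-along f x))
      ≈⟨ *-cong ≈-refl (∑-cong vertices (λ {x} _ → eigen x)) ⟩
    2# * ∑ vertices (λ x → D * μ * f x ²)
      ≈⟨ *-cong ≈-refl (∑-* vertices (D * μ) _) ⟩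
    2# * (D * μ * energy)
      ≈⟨ solve 3 (λ d m e → (con 1 :+ con 1) :* (d :* m :* e)
                            := (con 1 :+ con 1) :* d :* m :* e) ≈-refl D μ energy ⟩
    2# * D * μ * energy ∎))
    where
    D energy : Carrier
    D      = ofℕ d
    energy = ∑ vertices (λ x → f x ²)

    energy≉0 : ¬ (energy ≈ 0#)
    energy≉0 energy≈0 = fx₀≉0 (x²≤0⇒x≈0 (≤-trans
      (term≤∑ vertices (λ _ → *-square-nonneg _) (∈-allFin x₀)) (≤-reflexive energy≈0)))

    sup≤∑ : ∀ x → sup₀ (neighbours x) (λ y → ∣ difference-along f x y ∣ᵣ ²)
                  ≤ ∑ (neighbours x) (λ y → difference-along f x y ²)
    sup≤∑ x = sup₀-least (neighbours x) _ (∑-nonneg (neighbours x) (λ _ → *-square-nonneg _))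
      (λ y∈ → ≤-trans (≤-reflexive (∣x∣²≈x² _))
        (term≤∑ (neighbours x) (λ _ → *-square-nonneg _) y∈))

    eigen : ∀ x → f x * ∑ (neighbours x) (difference-along f x) ≈ D * μ * f x ²
    eigen x = begin-equality
      f x * T                    ≈⟨ *-cong ≈-refl (*-identityˡ T) ⟨
      f x * (1# * T)             ≈⟨ *-cong ≈-refl (*-cong (*-inverseʳ (ofℕ≉0 1≤d)) ≈-refl) ⟨
      -- Once reassociated, `D ⁻¹ * T` is `Δ d f x` by definition.
      f x * (D * D ⁻¹ * T)       ≈⟨ *-cong ≈-refl (*-assoc _ _ _) ⟩
      f x * (D * Δ d f x)  ≈⟨ *-cong ≈-refl (*-cong ≈-refl (Δf≈μf x)) ⟩
      f x * (D * (μ * f x))      ≈⟨ solve 3 (λ p d m → p :* (d :* (m :* p)) := d :* m :* (p :* p))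
                                      ≈-refl (f x) D μ ⟩
      D * μ * f x ²              ∎
      where
      T : Carrier
      T = ∑ (neighbours x) (difference-along f x)

  -- The isoperimetric constant and its bounds.

  boundary : Subset n → Carrier
  boundary V₁ = ofℕ (length (∂out V₁))

  -- Sign choices are functions here, so that `sign ∘ f` can be inserted directly.
  conflict : Subset n → (Fin n → Sign) → Fin n → Carrier
  conflict V₁ τ x = sup₀ (filter (_∈? V₁) (neighbours x)) (λ y →
    ∣ ofSign (τ x) - ofSign (σ x y) * ofSign (τ y) ∣ᵣ)

  totalConflict : Subset n → (Fin n → Sign) → Carrier
  totalConflict V₁ τ = ∑ (filter (_∈? V₁) vertices) (conflict V₁ τ)

  signVectors : List (Vec Sign n)
  signVectors = allVecs (Sign.+ ∷ Sign.- ∷ []) n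

  -- The vector `tabulate τ` competes in the minimum and the factor ½ cancels. It agrees with `τ`
  -- only pointwise, hence the term-by-term comparison of suprema.
  2ι∞≤totalConflict : ∀ V₁ τ → 2# * ι∞ V₁ ≤ totalConflict V₁ τ
  2ι∞≤totalConflict V₁ τ = begin
    2# * ι∞ V₁
      ≤⟨ *-monoʳ-≤ 0≤2 (minimum-lower (Vec.replicate n Sign.+) signVectors (frustration V₁)
           (∈-allVecs signs (tabulate τ))) ⟩
    2# * frustration V₁ (tabulate τ)
      ≈⟨ ½-inverse _ ⟩
    totalConflict V₁ (lookup (tabulate τ))
      ≤⟨ ∑-mono (filter (_∈? V₁) vertices) (λ {x} _ → retabulated x) ⟩
    totalConflict V₁ τ ∎
    where
    signs : ∀ s → s ∈ Sign.+ ∷ Sign.- ∷ []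
    signs Sign.+ = here refl
    signs Sign.- = there (here refl)
    retabulated : ∀ x → conflict V₁ (lookup (tabulate τ)) x ≤ conflict V₁ τ x
    retabulated x = sup₀-least ys _ (sup₀-nonneg ys (gap τ)) (λ {y} y∈ → ≤-trans
      (≤-reflexive (≈-reflexive (cong₂ (λ s t → ∣ ofSign s - ofSign (σ x y) * ofSign t ∣ᵣ)
        (lookup∘tabulate τ x) (lookup∘tabulate τ y))))
      (sup₀-upper ys (gap τ) y∈))
      where
      ys : List (Fin n)
      ys = filter (_∈? V₁) (neighbours x)
      gap : (Fin n → Sign) → Fin n → Carrier
      gap ρ y = ∣ ofSign (ρ x) - ofSign (σ x y) * ofSign (ρ y) ∣ᵣ

  ∣nonempty∣≉0 : ∀ {V₁ : Subset n} → Nonempty V₁ → ¬ (ofℕ ∣ V₁ ∣ ≈ 0#)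
  ∣nonempty∣≉0 (_ , x∈V₁) = ofℕ≉0 (ℕ.≤-trans (s≤s z≤n) (x∈p⇒∣p-x∣<∣p∣ x∈V₁))

  2ι∞+boundary-nonneg : ∀ V₁ → 0# ≤ 2# * ι∞ V₁ + boundary V₁
  2ι∞+boundary-nonneg V₁ = +-nonneg
    (*-nonneg 0≤2
      (minimum-greatest (Vec.replicate n Sign.+) signVectors (frustration V₁)
        (nonneg (Vec.replicate n Sign.+)) (λ {τ} _ → nonneg τ)))
    (ofℕ-nonneg (length (∂out V₁)))
    where
    nonneg : ∀ τ → 0# ≤ frustration V₁ τ
    nonneg τ = *-nonneg (⁻¹-nonneg 0≤2 2≉0)
      (∑-nonneg (filter (_∈? V₁) vertices) (λ {x} _ → sup₀-nonneg (filter (_∈? V₁) (neighbours x)) _))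

  -- The vertex makes `⊤`, the seed of the minimum, nonempty; otherwise its ratio would involve the
  -- unconstrained inverse of 0.
  hout-nonneg : Fin n → 0# ≤ hout
  hout-nonneg x₀ = minimum-greatest ⊤ _ ratio (nonneg (x₀ , ∈⊤))
    (λ V₁∈ → nonneg (proj₂ (∈-filter⁻ nonempty? {xs = allVecs _ n} V₁∈)))
    where
    nonneg : ∀ {V₁} → Nonempty V₁ → 0# ≤ ratio V₁
    nonneg {V₁} ne = *-nonneg (2ι∞+boundary-nonneg V₁)
      (⁻¹-nonneg (ofℕ-nonneg ∣ V₁ ∣) (∣nonempty∣≉0 ne))

  -- The definition of h with the denominator cleared. This form extends to the empty set, which
  -- occurs as a superlevel set at high levels.
  isoperimetric : ∀ V₁ τ → hout * ofℕ ∣ V₁ ∣ ≤ totalConflict V₁ τ + boundary V₁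
  isoperimetric V₁ τ = ≤-trans bound (+-monoˡ-≤ (boundary V₁) (2ι∞≤totalConflict V₁ τ))
    where
    booleans : ∀ b → b ∈ true ∷ false ∷ []
    booleans true  = here refl
    booleans false = there (here refl)

    bound : hout * ofℕ ∣ V₁ ∣ ≤ 2# * ι∞ V₁ + boundary V₁
    bound with nonempty? V₁
    ... | yes ne = begin
      hout * ofℕ ∣ V₁ ∣
        ≤⟨ *-monoˡ-≤ (ofℕ-nonneg ∣ V₁ ∣) (minimum-lower ⊤
             (filter nonempty? (allVecs (true ∷ false ∷ []) n)) ratio
             (∈-filter⁺ nonempty? (∈-allVecs booleans V₁) ne)) ⟩
      ratio V₁ * ofℕ ∣ V₁ ∣
        ≈⟨ ≈-trans (*-assoc _ _ _) (≈-trans (*-cong ≈-refl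
             (≈-trans (*-comm _ _) (*-inverseʳ (∣nonempty∣≉0 ne)))) (*-identityʳ _)) ⟩
      2# * ι∞ V₁ + boundary V₁ ∎
    ... | no empty = ≤-trans
      (≤-reflexive (≈-trans (*-cong ≈-refl (≈-reflexive
        (cong ofℕ (trans (cong ∣_∣ (Empty-unique empty)) (∣⊥∣≡0 n))))) (zeroʳ _)))
      (2ι∞+boundary-nonneg V₁)

  -- The whole vertex set has empty outer boundary, and each vertex contributes a conflict of at
  -- most 2.
  hout≤2 : Fin n → hout ≤ 2#
  hout≤2 x₀ = *-cancelˡ-≤ (ofℕ-nonneg ∣ ⊤ {n} ∣) (∣nonempty∣≉0 (x₀ , ∈⊤))
    (≤-cong (*-comm _ _) ≈-refl (begin
    hout * ofℕ ∣ ⊤ {n} ∣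
      ≤⟨ isoperimetric ⊤ (λ _ → Sign.+) ⟩
    totalConflict ⊤ (λ _ → Sign.+) + boundary ⊤
      ≤⟨ +-mono-≤
           (∑-filter-≤ (_∈? ⊤) vertices (λ x _ →
             sup₀-least (filter (_∈? ⊤) (neighbours x)) _ 0≤2 (λ {y} _ →
             ofSign-difference-≤2 Sign.+ (σ x y) Sign.+)) (λ _ → 0≤2))
           (≤-trans (≤-reflexive (ofℕ-length (∂out ⊤)))
             (∑-filter-≤ _ vertices {g = λ _ → 0#} (λ _ (y∉⊤ , _) → contradiction ∈⊤ y∉⊤)
               (λ _ → ≤-refl))) ⟩
    ∑ vertices (λ _ → 2#) + ∑ vertices (λ _ → 0#)
      ≈⟨ ≈-trans (+-cong ≈-refl (∑-zero vertices)) (+-identityʳ _) ⟩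
    ∑ vertices (λ _ → 2#)
      ≈⟨ ∑-+ vertices _ _ ⟩
    ∑ vertices (λ _ → 1#) + ∑ vertices (λ _ → 1#)
      ≈⟨ +-cong ∣⊤∣ ∣⊤∣ ⟨
    ofℕ ∣ ⊤ {n} ∣ + ofℕ ∣ ⊤ {n} ∣
      ≈⟨ solve 1 (λ m → m :+ m := m :* (con 1 :+ con 1)) ≈-refl _ ⟩
    ofℕ ∣ ⊤ {n} ∣ * 2# ∎))
    where
    ∣⊤∣ : ofℕ ∣ ⊤ {n} ∣ ≈ ∑ vertices (λ _ → 1#)
    ∣⊤∣ = ofℕ-∣∣ {n = n} id ⊤ (λ _ → 1#) (λ i → ≈-reflexive
      (cong (if_then 1# else 0#) (sym ([]=⇒lookup (∈⊤ {x = i})))))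

  -- Superlevel sets.

  superlevel : (Fin n → Carrier) → Carrier → Subset n
  superlevel w t = tabulate (λ x → not (does (w x ≤? t)))

  ∈-superlevel : ∀ {w t x} → ¬ (w x ≤ t) → x ∈ₛ superlevel w t
  ∈-superlevel {w} {t} {x} wx≰t = lookup⇒[]= x _ (trans (lookup∘tabulate _ x) not-below)
    where
    not-below : not (does (w x ≤? t)) ≡ true
    not-below with w x ≤? t
    ... | yes wx≤t = contradiction wx≤t wx≰t
    ... | no  _    = refl

  superlevel-above : ∀ {w t x} → x ∈ₛ superlevel w t → ¬ (w x ≤ t)
  superlevel-above {w} {t} {x} x∈ wx≤t
    with w x ≤? t | trans (sym (lookup∘tabulate (λ y → not (does (w y ≤? t))) x)) ([]=⇒lookup x∈)
  ... | yes _    | ()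
  ... | no  wx≰t | _  = wx≰t wx≤t

  ofℕ-∣superlevel∣ : ∀ w t → ofℕ ∣ superlevel w t ∣ ≈ ∑ vertices (above t ∘ w)
  ofℕ-∣superlevel∣ w t = ofℕ-∣∣ id (superlevel w t) (above t ∘ w) (λ x →
    ≈-trans (indicator (does (w x ≤? t))) (≈-reflexive
      (cong (if_then 1# else 0#) (sym (lookup∘tabulate (λ y → not (does (w y ≤? t))) x)))))
    where
    indicator : ∀ b → (if b then 0# else 1#) ≈ (if not b then 1# else 0#)
    indicator true  = ≈-refl
    indicator false = ≈-refl

  -- The coarea inequality for a fixed function.

  module _ (f : Fin n → Carrier) where

    variation : Fin n → Carrier
    variation x = sup₀ (neighbours x) (λ y → ∣ difference-along f x y ∣ᵣ ²)

    -- This is s(x), the supremum of |g(x,y)| over the neighbours, taken as a root so that its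
    -- square is the Poincaré summand.
    deviation : Fin n → Carrier
    deviation x = √ (variation x)

    deviation-square : ∀ x → deviation x ² ≈ variation x
    deviation-square x = √-square (sup₀-nonneg (neighbours x) _)

    private
      energy s : Fin n → Carrier
      energy x = f x ²
      s = deviation

      0≤s : ∀ x → 0# ≤ s x
      0≤s x = √-nonneg (variation x)

      difference≤s : ∀ {x y} → y ∼ x → ∣ difference-along f x y ∣ᵣ ≤ s x
      difference≤s {x} y∼x = ²-cancel-≤ (0≤s x) (≤-trans
        (sup₀-upper (neighbours x) _ (∈-neighbours y∼x)) (≤-reflexive (≈-sym (deviation-square x))))

      -- An upper bound for f² at `x` and at all its neighbours. Hence {reach > t} contains {f² > t}
      -- together with its outer boundary.
      reach : Fin n → Carrier
      reach x = (∣ f x ∣ᵣ + s x) ²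

      energy≤reach : ∀ {x y} → y ∼ x → energy y ≤ reach x
      energy≤reach {x} {y} y∼x = ≤-trans (≤-reflexive (≈-sym (∣x∣²≈x² (f y))))
        (²-mono-≤ (∣∣-nonneg (f y)) (begin
          ∣ f y ∣ᵣ
            ≈⟨ ∣ofSign*∣ (σ x y) (f y) ⟨
          ∣ ofSign (σ x y) * f y ∣ᵣ
            ≤⟨ ∣∣-triangle (f x) _ ⟩
          ∣ f x ∣ᵣ + ∣ difference-along f x y ∣ᵣ
            ≤⟨ +-monoʳ-≤ _ (difference≤s y∼x) ⟩
          ∣ f x ∣ᵣ + s x ∎))

      energy≤own-reach : ∀ x → energy x ≤ reach x
      energy≤own-reach x = ≤-trans (≤-reflexive (≈-sym (∣x∣²≈x² (f x))))
        (²-mono-≤ (∣∣-nonneg (f x)) (x≤x+d (0≤s x)))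

    module _ (b : Fin n → Carrier) (0≤b : ∀ x → 0# ≤ b x)
             (b-threshold : ∀ x v → ∣ f x ∣ᵣ + v ≤ s x → ∣ f x ∣ᵣ ≤ b x ⊎ v ≤ b x) where

      private
        energy≤b² : ∀ {x y} → ∣ f y ∣ᵣ ≤ b x → energy y ≤ b x ²
        energy≤b² {x} {y} ∣fy∣≤b =
          ≤-trans (≤-reflexive (≈-sym (∣x∣²≈x² (f y)))) (²-mono-≤ (∣∣-nonneg (f y)) ∣fy∣≤b)

        module _ (t : Carrier) where

          V : Subset n
          V = superlevel energy t

          -- A neighbour y in conflict satisfies |f x| + |f y| ≤ s x, so |f x| or |f y| is at most
          -- `b x`. Both vertices lie in {f² > t}, which forces b² > t.
          conflict≤ : ∀ x → x ∈ₛ V → conflict V (sign ∘ f) x ≤ 2# * above t (b x ²)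
          conflict≤ x x∈V = sup₀-least (filter (_∈? V) (neighbours x)) _ 0≤rhs each
            where
            0≤rhs : 0# ≤ 2# * above t (b x ²)
            0≤rhs = *-nonneg 0≤2 (above-nonneg t (b x ²))
            saturated : ∀ {y} → y ∈ₛ V → ∣ f y ∣ᵣ ≤ b x → 2# ≤ 2# * above t (b x ²)
            saturated {y} y∈V ∣fy∣≤b = ≤-reflexive (≈-trans (≈-sym (*-identityʳ 2#))
              (*-cong ≈-refl (≈-sym (above-one (λ b²≤t →
                superlevel-above y∈V (≤-trans (energy≤b² ∣fy∣≤b) b²≤t))))))
            each : ∀ {y} → y ∈ filter (_∈? V) (neighbours x) →
                   ∣ ofSign (sign (f x)) - ofSign (σ x y) * ofSign (sign (f y)) ∣ᵣ
                     ≤ 2# * above t (b x ²)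
            each {y} y∈ with ∈-filter⁻ (_∈? V) {xs = neighbours x} y∈
                           | sign-difference (σ x y) (f x) (f y)
            ... | _         , _   | inj₁ ≈0         = ≤-trans (≤-reflexive ≈0) 0≤rhs
            ... | y∈nbrs , y∈V | inj₂ (≈2 , opposed) = ≤-trans (≤-reflexive ≈2)
              (Sum.[ saturated x∈V , saturated y∈V ] (b-threshold x ∣ f y ∣ᵣ
                (≤-trans (≤-reflexive (≈-sym opposed)) (difference≤s (neighbours-∼ y∈nbrs)))))

          -- The neighbour in `V` has f² > t and is within the reach of `y`, whereas f² ≤ t at `y`
          -- itself.
          outside≤ : ∀ y → ¬ (y ∈ₛ V) → (∃ λ x → x ∈ₛ V × x ∼ y) →
                     1# ≤ above t (reach y) - above t (energy y)
          outside≤ y y∉V (x , x∈V , x∼y) = ≤-reflexive (≈-sym (begin-equality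
            above t (reach y) - above t (energy y)
              ≈⟨ +-cong (above-one (λ reach≤t →
                   superlevel-above x∈V (≤-trans (energy≤reach x∼y) reach≤t))) (-‿cong above≈0) ⟩
            1# - 0#
              ≈⟨ +-cong (+-identityʳ 1#) ≈-refl ⟨
            (1# + 0#) - 0#
              ≈⟨ cancel 1# 0# ⟩
            1# ∎))
            where
            above≈0 : above t (energy y) ≈ 0#
            above≈0 with energy y ≤? t
            ... | yes _   = ≈-refl
            ... | no  e≰t = contradiction (∈-superlevel e≰t) y∉V

          -- Counts `V` and its disjoint outer boundary inside {reach > t}; vertices off the
          -- boundary contribute nonnegative differences because f² ≤ reach.
          boundary≤ : boundary V + ∑ vertices (above t ∘ energy) ≤ ∑ vertices (above t ∘ reach)
          boundary≤ = begin
            boundary V + ∑ vertices (above t ∘ energy)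
              ≤⟨ +-monoˡ-≤ _ (≤-trans (≤-reflexive (ofℕ-length (∂out V)))
                   (∑-filter-≤ _ vertices (λ y (y∉V , x) → outside≤ y y∉V x)
                     (λ y → x≤y⇒0≤y-x (above-mono t (energy≤own-reach y))))) ⟩
            ∑ vertices (λ y → above t (reach y) - above t (energy y)) + ∑ vertices (above t ∘ energy)
              ≈⟨ ∑-+ vertices _ _ ⟨
            ∑ vertices (λ y → (above t (reach y) - above t (energy y)) + above t (energy y))
              ≈⟨ ∑-cong vertices (λ {y} _ → x-y+y≈x (above t (reach y)) (above t (energy y))) ⟩
            ∑ vertices (above t ∘ reach) ∎

          -- The isoperimetric inequality for `V` with signs `sign ∘ f`. Adding |V| to both sides
          -- completes the boundary count to `boundary≤`.
          level : (1# + hout) * ∑ vertices (above t ∘ energy) ≤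
                  2# * ∑ vertices (λ x → above t (b x ²)) + ∑ vertices (above t ∘ reach)
          level = begin
            (1# + hout) * W
              ≈⟨ solve 2 (λ h w → (con 1 :+ h) :* w := h :* w :+ w) ≈-refl hout W ⟩
            hout * W + W
              ≈⟨ +-cong (*-cong ≈-refl (≈-sym (ofℕ-∣superlevel∣ energy t))) ≈-refl ⟩
            hout * ofℕ ∣ V ∣ + W
              ≤⟨ +-monoˡ-≤ W (isoperimetric V (sign ∘ f)) ⟩
            (totalConflict V (sign ∘ f) + boundary V) + W
              ≈⟨ +-assoc _ _ _ ⟩
            totalConflict V (sign ∘ f) + (boundary V + W)
              ≤⟨ +-mono-≤ (∑-filter-≤ (_∈? V) vertices conflict≤
                   (λ x → *-nonneg 0≤2 (above-nonneg t (b x ²)))) boundary≤ ⟩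
            ∑ vertices (λ x → 2# * above t (b x ²)) + ∑ vertices (above t ∘ reach)
              ≈⟨ +-cong (∑-* vertices 2# _) ≈-refl ⟩
            2# * ∑ vertices (λ x → above t (b x ²)) + ∑ vertices (above t ∘ reach) ∎
            where
            W : Carrier
            W = ∑ vertices (above t ∘ energy)

      -- Both sides of `level` are indicator sums with coefficients 1 + h on the left and 2 and 1 on
      -- the right, so `layerCake` replaces the indicators by the values.
      coarea : (1# + hout) * ∑ vertices energy ≤ ∑ vertices (λ x → 2# * b x ² + reach x)
      coarea = ≤-cong (weigh-constant (1# + hout) energy id)
        (≈-trans (weigh-two id) (≈-trans (+-cong (≈-sym (∑-* vertices 2# _)) ≈-refl)
          (≈-sym (∑-+ vertices _ _))))
        (layerCake (constant (1# + hout) energy) two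
          (All.++⁺ (nonneg energy (λ x → *-square-nonneg (f x)))
            (All.++⁺ (nonneg _ (λ x → *-square-nonneg (b x)))
                     (nonneg _ (λ x → *-square-nonneg (∣ f x ∣ᵣ + s x)))))
          (λ t _ → ≤-cong (≈-sym (weigh-constant (1# + hout) energy (above t)))
            (≈-sym (weigh-two (above t))) (level t)))
        where
        constant : Carrier → (Fin n → Carrier) → List (Carrier × Carrier)
        constant z v = map (λ x → z , v x) vertices

        two : List (Carrier × Carrier)
        two = constant 2# (λ x → b x ²) ++ constant 1# reach

        nonneg : ∀ {z} v → (∀ x → 0# ≤ v x) → All (λ p → 0# ≤ proj₂ p) (constant z v)
        nonneg v 0≤v = All.map⁺ (All.universal 0≤v vertices)

        weigh-constant : ∀ z v φ → weigh (constant z v) φ ≈ z * ∑ vertices (φ ∘ v)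
        weigh-constant z v φ =
          ≈-trans (≈-reflexive (∑-map (λ x → z , v x) vertices _)) (∑-* vertices z _)

        weigh-two : ∀ φ → weigh two φ ≈ 2# * ∑ vertices (λ x → φ (b x ²)) + ∑ vertices (φ ∘ reach)
        weigh-two φ = ≈-trans (∑-++ (constant 2# (λ x → b x ²)) (constant 1# reach) _)
          (+-cong (weigh-constant 2# _ φ) (≈-trans (weigh-constant 1# reach φ) (*-identityˡ _)))

  -- The lower bound.

  [√[1+hout]-1]²-poincaré : Fin n → IsPoincaréConstant ((√ (1# + hout) - 1#) ²)
  -- Adding κW and multiplying by κ + 1 > 0 turns the left side into κ(κ + 1)²W = κ(1 + h)W, ready
  -- for `coarea`. Nothing is divided by κ, which may be 0.
  [√[1+hout]-1]²-poincaré x₀ f = +-cancelʳ-≤ (κ * W) (*-cancelˡ-≤ 0≤κ+1 κ+1≉0 (begin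
    (κ + 1#) * (κ ² * W + κ * W)
      ≈⟨ solve 2 (λ κ w → (κ :+ con 1) :* (κ :* κ :* w :+ κ :* w)
                          := κ :* ((κ :+ con 1) :* (κ :+ con 1) :* w)) ≈-refl κ W ⟩
    κ * ((κ + 1#) ² * W)
      ≈⟨ *-cong ≈-refl (*-cong (√[1+h]-1-square 0≤h h≤2) ≈-refl) ⟩
    κ * ((1# + hout) * W)
      ≤⟨ *-monoʳ-≤ 0≤κ (coarea f (proj₁ ∘ threshold) (proj₁ ∘ proj₂ ∘ threshold)
           (λ x → proj₂ (proj₂ (proj₂ (threshold x))))) ⟩
    κ * ∑ vertices (λ x → 2# * b x ² + (∣ f x ∣ᵣ + s x) ²)
      ≈⟨ ∑-* vertices κ _ ⟨
    ∑ vertices (λ x → κ * (2# * b x ² + (∣ f x ∣ᵣ + s x) ²))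
      ≤⟨ ∑-mono vertices (λ {x} _ → proj₁ (proj₂ (proj₂ (threshold x)))) ⟩
    ∑ vertices (λ x → (κ + 1#) * s x ² + (κ * (κ + 1#)) * ∣ f x ∣ᵣ ²)
      ≈⟨ ∑-+ vertices _ _ ⟩
    ∑ vertices (λ x → (κ + 1#) * s x ²) + ∑ vertices (λ x → (κ * (κ + 1#)) * ∣ f x ∣ᵣ ²)
      ≈⟨ +-cong (∑-* vertices _ _) (∑-* vertices _ _) ⟩
    (κ + 1#) * ∑ vertices (λ x → s x ²) + (κ * (κ + 1#)) * ∑ vertices (λ x → ∣ f x ∣ᵣ ²)
      ≈⟨ +-cong (*-cong ≈-refl (∑-cong vertices (λ {x} _ → deviation-square f x)))
                (*-cong ≈-refl (∑-cong vertices (λ {x} _ → ∣x∣²≈x² (f x)))) ⟩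
    (κ + 1#) * Q + (κ * (κ + 1#)) * W
      ≈⟨ solve 3 (λ κ q w → (κ :+ con 1) :* q :+ (κ :* (κ :+ con 1)) :* w
                            := (κ :+ con 1) :* (q :+ κ :* w)) ≈-refl κ Q W ⟩
    (κ + 1#) * (Q + κ * W) ∎))
    where
    κ W Q : Carrier
    κ = √ (1# + hout) - 1#
    W = ∑ vertices (λ x → f x ²)
    Q = ∑ vertices (variation f)

    0≤h : 0# ≤ hout
    0≤h = hout-nonneg x₀
    h≤2 : hout ≤ 2#
    h≤2 = hout≤2 x₀

    0≤κ : 0# ≤ κ
    0≤κ = √[1+h]-1-nonneg 0≤h h≤2

    0≤κ+1 : 0# ≤ κ + 1#
    0≤κ+1 = +-nonneg 0≤κ 0≤1

    κ+1≉0 : ¬ (κ + 1# ≈ 0#)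
    κ+1≉0 κ+1≈0 = 0≉1 (≈-sym (0≤x+y≈0⇒x≈0 0≤1 0≤κ (≈-trans (+-comm 1# κ) κ+1≈0)))

    s : Fin n → Carrier
    s = deviation f

    threshold : ∀ x → ∃ λ b → 0# ≤ b ×
      κ * (2# * b ² + (∣ f x ∣ᵣ + s x) ²) ≤ (κ + 1#) * s x ² + (κ * (κ + 1#)) * ∣ f x ∣ᵣ ² ×
      (∀ v → ∣ f x ∣ᵣ + v ≤ s x → ∣ f x ∣ᵣ ≤ b ⊎ v ≤ b)
    -- Since κ ≤ 1, the number ρ = 1 - κ is nonnegative.
    threshold x with difference (√[1+h]-1-≤1 0≤h h≤2)
    ... | ρ , 0≤ρ , 1≈κ+ρ = frustrationThreshold 0≤κ 0≤ρ 1≈κ+ρ (√[1+h]-1-gap 0≤h h≤2 1≈κ+ρ)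
                              (∣∣-nonneg (f x)) (√-nonneg (variation f x))

    b : Fin n → Carrier
    b = proj₁ ∘ threshold

theorem1p2 : ∀ {c ℓ₁ ℓ₂} (ℝ : CompleteOrderedField c ℓ₁ ℓ₂)
      {n : ℕ} (G : Graph n) (S : Signature G) (d : ℕ) →
    let open CompleteOrderedField ℝ
        open RealOperations ℝ
        open SignedGraphConstants ℝ G S
    in
    1 ≤ℕ d → Graph.Regular G d →
    ∀ (λ₁ λ∞ : Carrier) → IsSmallestEigenvalue d λ₁ → IsOptimalPoincaréConstant λ∞ →
    (λ∞ ≤ (1# + 1#) * ofℕ d * λ₁) × ((√ (1# + hout) - 1#) ² ≤ λ∞)
theorem1p2 ℝ G S d 1≤d _ λ₁ λ∞ (eigen@(_ , (x₀ , _) , _) , _) (poincaré , optimal) =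
  -- A point where the eigenfunction does not vanish also supplies the vertex required by the lower
  -- bound.
  poincaré≤eigenvalue 1≤d eigen poincaré , optimal _ ([√[1+hout]-1]²-poincaré x₀)
  where open SignedGraphInequalities ℝ G S
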